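{- Let $q=2^h$ for a positive integer $h$, and let $U=\{(x,\,y,\,x^q+y^{q^2},\,x^{q^2}+y^q+y^{q^2}) : x,y\in\mathbb{F}_{q^4}\}\subseteq\mathbb{F}_{q^4}^4$. Then $U$ is a maximum scattered $\mathbb{F}_q$-subspace of $\mathbb{F}_{q^4}^4$ if and only if $h\not\equiv 2\pmod 4$.
   Context: $U$ is an $\mathbb{F}_q$-subspace of $\mathbb{F}_{q^4}^4$ of $\mathbb{F}_q$-dimension $8$. An $\mathbb{F}_q$-subspace $U$ of $\mathbb{F}_{q^m}^k$ is scattered if $\dim_{\mathbb{F}_q}(U\cap\langle w\rangle_{\mathbb{F}_{q^m}})\le 1$ for every nonzero $w\in\mathbb{F}_{q^m}^k$; it is maximum scattered if moreover $\dim_{\mathbb{F}_q}(U)=km/2$ (here $km/2=8$). -}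

module Defs where

open import Level using (Level; _⊔_)
open import Data.Nat using (ℕ; zero; suc)
open import Data.Fin using (Fin; zero; suc)
open import Data.Product using (Σ; ∃; _×_; _,_)
open import Relation.Nullary using (¬_)
open import Relation.Binary.PropositionalEquality as ≡ using (_≡_)
open import Algebra.Bundles using (CommutativeRing)
open import Function.Bundles using (Bijection)

record Field (c ℓ : Level) : Set (Level.suc (c ⊔ ℓ)) where
  field
    commRing : CommutativeRing c ℓ
  open CommutativeRing commRing public
  field
    1≉0     : ¬ (1# ≈ 0#)
    inverse : ∀ x → ¬ (x ≈ 0#) → Σ Carrier λ y → x * y ≈ 1#

HasOrder : ∀ {c ℓ} → Field c ℓ → ℕ → Set (c ⊔ ℓ)
HasOrder K n = Bijection (Field.setoid K) (≡.setoid (Fin n))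

module Over {c ℓ} (K : Field c ℓ) where
  open Field K using (Carrier; _≈_; _+_; _*_; 0#; 1#)

  pow : Carrier → ℕ → Carrier
  pow x zero    = 1#
  pow x (suc n) = x * pow x n

  sumF : ∀ {n} → (Fin n → Carrier) → Carrier
  sumF {zero}  f = 0#
  sumF {suc n} f = f zero + sumF (λ i → f (suc i))

  Vect : ℕ → Set c
  Vect k = Fin k → Carrier

  _≈ᵥ_ : ∀ {k} → Vect k → Vect k → Set ℓ
  u ≈ᵥ v = ∀ i → u i ≈ v i

  0ᵥ : ∀ {k} → Vect k
  0ᵥ i = 0#

  _·_ : ∀ {k} → Carrier → Vect k → Vect k
  (a · v) i = a * v i

  _+ᵥ_ : ∀ {k} → Vect k → Vect k → Vect k
  (u +ᵥ v) i = u i + v i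

  lincomb : ∀ {k n} → (Fin n → Carrier) → (Fin n → Vect k) → Vect k
  lincomb a b i = sumF (λ j → a j * b j i)

  VSet : ℕ → Set (Level.suc (c ⊔ ℓ))
  VSet k = Vect k → Set (c ⊔ ℓ)

  module Subfield (q : ℕ) where
    InFq : Carrier → Set ℓ
    InFq a = pow a q ≈ a

    InSpanFq : ∀ {k n} → (Fin n → Vect k) → Vect k → Set (c ⊔ ℓ)
    InSpanFq b v = Σ (Fin _ → Carrier) λ a → (∀ j → InFq (a j)) × (v ≈ᵥ lincomb a b)

    LinIndepFq : ∀ {k n} → (Fin n → Vect k) → Set (c ⊔ ℓ)
    LinIndepFq b = ∀ a → (∀ j → InFq (a j)) → lincomb a b ≈ᵥ 0ᵥ → ∀ j → a j ≈ 0#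

    IsSubspaceOfDim : ∀ {k} → VSet k → ℕ → Set (c ⊔ ℓ)
    IsSubspaceOfDim {k} U d =
      Σ (Fin d → Vect k) λ b → LinIndepFq b × (∀ v → (U v → InSpanFq b v) × (InSpanFq b v → U v))

    DimIntersectionLine≤1 : ∀ {k} → VSet k → Vect k → Set (c ⊔ ℓ)
    DimIntersectionLine≤1 U w =
      ∀ u₁ u₂ → U u₁ → U u₂ →
        (Σ Carrier λ λ₁ → u₁ ≈ᵥ (λ₁ · w)) → (Σ Carrier λ λ₂ → u₂ ≈ᵥ (λ₂ · w)) →
        Σ Carrier λ a₁ → Σ Carrier λ a₂ → InFq a₁ × InFq a₂ ×
          (¬ (a₁ ≈ 0# × a₂ ≈ 0#)) × ((a₁ · u₁) +ᵥ (a₂ · u₂)) ≈ᵥ 0ᵥ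

    Scattered : ∀ {k} → VSet k → Set (c ⊔ ℓ)
    Scattered {k} U = (w : Vect k) → ¬ (w ≈ᵥ 0ᵥ) → DimIntersectionLine≤1 U w

    -- maximum scattered F_q-subspace of K^k, where [K : F_q] = m: dimension k*m/2
    MaximumScattered : ∀ {k} → VSet k → ℕ → Set (c ⊔ ℓ)
    MaximumScattered U halfkm = IsSubspaceOfDim U halfkm × Scattered U

module Thm {c ℓ} (K : Field c ℓ) (q : ℕ) where
  open Field K using (Carrier; _+_)
  open Over K

  vecU : Carrier → Carrier → Vect 4
  vecU x y zero                   = x
  vecU x y (suc zero)             = y
  vecU x y (suc (suc zero))       = pow x q + pow y (q Data.Nat.* q)
  vecU x y (suc (suc (suc zero))) = pow x (q Data.Nat.* q) + pow y q + pow y (q Data.Nat.* q)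

  U : VSet 4
  U v = Σ Carrier λ x → Σ Carrier λ y → v ≈ᵥ vecU x y

{-# OPTIONS --safe #-}
module Submission where

-- Write σ x = x^q. If l (x, y, …) lies in U with l ∉ F_q, put a = σ l + l, b = a + σ a and u = b σ²y / (a σ y).
-- The two equations collapse to u σ(u) + u + 1 = 0, so σ acts on u by a Möbius map of order 3; as σ has order
-- dividing 4, u lies in F_q and is a primitive cube root of unity. Then v = a σ²(a) / (b σ b) satisfies
-- v² + v = u² and σ v = v + 1. So F_q contains F₄ = F₂(u) but not v ∈ F₁₆, i.e. h ≡ 2 mod 4.
-- Conversely, for h ≡ 2 mod 4 the field contains F₂₅₆, built as a tower of Artin–Schreier extensions, on which σ is
-- x ↦ x^(2^r) with r = h mod 8 ∈ {2, 6}; an explicit l, x, y in F₂₅₆ is checked for each r by computation.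
open import Defs
open import Level using (Level; _⊔_; 0ℓ)
open import Algebra.Bundles using (RawRing)
open import Algebra.Bundles.Raw using (RawSemiring)
import Algebra.Properties.CommutativeMonoid.Sum as Sum
import Algebra.Properties.Group as GroupProperties
import Algebra.Properties.Monoid.Mult as MonoidMult
import Algebra.Properties.Semiring.Exp as Exp
import Algebra.Properties.Semiring.Mult as SemiringMult
import Algebra.Solver.Ring as RingSolver
open import Algebra.Solver.Ring.AlmostCommutativeRing using (AlmostCommutativeRing; fromCommutativeSemiring; _-Raw-AlmostCommutative⟶_)
open import Data.Bool using (Bool; true; false; _xor_; _∧_)
open import Data.Fin using (Fin; zero; suc; inject≤; punchIn; _↑ˡ_; _↑ʳ_)
open import Data.Fin.Permutation using (Permutation′; permutation)
import Data.Fin.Properties as Fin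
open import Data.Maybe using (Maybe; just; nothing)
open import Data.Nat as ℕ using (ℕ; zero; suc; _^_; _%_; _≥_)
import Data.Nat.DivMod as ℕ
import Data.Nat.Properties as ℕ
open import Data.Nat.Solver using (module +-*-Solver)
open import Data.Product using (Σ; _×_; _,_; proj₁; proj₂)
open import Data.Sum using (_⊎_; inj₁; inj₂)
open import Data.Vec.Functional using (_++_; _∷_; [])
open import Data.Vec.Functional.Properties using (lookup-++ˡ; lookup-++ʳ)
open import Function.Base using (_∘_; id)
open import Function.Bundles using (Inverse)
open import Function.Properties.Bijection using (Bijection⇒Inverse)
open import Relation.Binary.PropositionalEquality as ≡ using (_≡_; _≢_)
import Relation.Binary.Reasoning.Setoid as SetoidReasoning
open import Relation.Nullary using (¬_; Dec; yes; no; contradiction)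
open import Relation.Nullary.Decidable using (map′)

-- F_q never appears as a type: it is the fixed set of σ, so membership, conjugates and independence
-- over it are all statements about σ. Two things must be produced from the cardinality of K alone:
-- a basis over F_q, which gives U dimension 8 for every h, and roots of X² + X + c, which give the
-- copy of F₂₅₆. Both come from a single element of absolute trace 1. It exists because the trace is
-- a monic polynomial whose degree is half the order of K. The origin of v: once u is fixed by σ,
-- the four conjugates of a σ(y) u = b σ²(y) all contain the same u, and in their product the
-- conjugates of y cancel. This leaves the norm of a, times u, equal to (b σ b)². That norm is the
-- product of a σ²(a) and its conjugate, and their sum is b σ b because a = σ l + l has relative
-- trace 0. Sum and product are thus known, and dividing by b σ b gives a quadratic equation over
-- F₄.

Characteristic2 : ∀ {c ℓ} → Field c ℓ → Set ℓ
Characteristic2 K = 1# + 1# ≈ 0#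
  where open Field K

-- Cancellation in a field

module FieldProperties {c ℓ} (K : Field c ℓ) where
  open Field K hiding (zero)
  open SetoidReasoning setoid

  1/ : ∀ x → ¬ (x ≈ 0#) → Carrier
  1/ x x≉0 = proj₁ (inverse x x≉0)

  1/-inverseʳ : ∀ x (x≉0 : ¬ (x ≈ 0#)) → x * 1/ x x≉0 ≈ 1#
  1/-inverseʳ x x≉0 = proj₂ (inverse x x≉0)

  *-cancelˡ : ∀ {x y z} → ¬ (x ≈ 0#) → x * y ≈ x * z → y ≈ z
  *-cancelˡ {x} {y} {z} x≉0 xy≈xz = begin
    y                     ≈⟨ undo y ⟨
    1/ x x≉0 * (x * y)    ≈⟨ *-congˡ xy≈xz ⟩
    1/ x x≉0 * (x * z)    ≈⟨ undo z ⟩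
    z                     ∎
    where
    undo : ∀ w → 1/ x x≉0 * (x * w) ≈ w
    undo w = begin
      1/ x x≉0 * (x * w)  ≈⟨ *-assoc _ _ _ ⟨
      1/ x x≉0 * x * w    ≈⟨ *-congʳ (trans (*-comm _ _) (1/-inverseʳ x x≉0)) ⟩
      1# * w              ≈⟨ *-identityˡ w ⟩
      w                   ∎

  xy≈0⇒y≈0 : ∀ {x y} → ¬ (x ≈ 0#) → x * y ≈ 0# → y ≈ 0#
  xy≈0⇒y≈0 x≉0 xy≈0 = *-cancelˡ x≉0 (trans xy≈0 (sym (zeroʳ _)))

  *-≉0 : ∀ {x y} → ¬ (x ≈ 0#) → ¬ (y ≈ 0#) → ¬ (x * y ≈ 0#)
  *-≉0 x≉0 y≉0 xy≈0 = y≉0 (xy≈0⇒y≈0 x≉0 xy≈0)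

-- Sums and products over all elements of a finite field

module FiniteField {c ℓ} (K : Field c ℓ) {n : ℕ} (order : HasOrder K n) where
  open Field K hiding (zero)
  open FieldProperties K
  open Over K using (pow)
  open SetoidReasoning setoid
  open Inverse (Bijection⇒Inverse order) public
    using () renaming (to to index; from to elem; to-cong to index-cong)

  elem∘index : ∀ x → elem (index x) ≈ x
  elem∘index x = Inverse.inverseʳ (Bijection⇒Inverse order) ≡.refl

  index∘elem : ∀ i → index (elem i) ≡ i
  index∘elem i = Inverse.inverseˡ (Bijection⇒Inverse order) refl

  index-injective : ∀ {x y} → index x ≡ index y → x ≈ y
  index-injective {x} {y} eq =
    trans (sym (elem∘index x)) (trans (reflexive (≡.cong elem eq)) (elem∘index y))

  elem-injective : ∀ {i j} → elem i ≈ elem j → i ≡ j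
  elem-injective {i} {j} eq =
    ≡.trans (≡.sym (index∘elem i)) (≡.trans (index-cong eq) (index∘elem j))

  infix 4 _≟_
  _≟_ : ∀ x y → Dec (x ≈ y)
  x ≟ y = map′ index-injective index-cong (index x Fin.≟ index y)

  -- Turns a bijection of the field into a permutation of indices, so that sums and products over
  -- all elements can be reindexed by it.
  transport : (f g : Carrier → Carrier) → (∀ {x y} → x ≈ y → f x ≈ f y) → (∀ {x y} → x ≈ y → g x ≈ g y) →
              (∀ x → f (g x) ≈ x) → (∀ x → g (f x) ≈ x) → Permutation′ n
  transport f g f-cong g-cong fg gf =
    permutation (index ∘ f ∘ elem) (index ∘ g ∘ elem) (inv f g f-cong fg) (inv g f g-cong gf)
    where
    inv : ∀ (f g : Carrier → Carrier) → (∀ {x y} → x ≈ y → f x ≈ f y) → (∀ x → f (g x) ≈ x) →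
          ∀ i → index (f (elem (index (g (elem i))))) ≡ i
    inv f g f-cong fg i = ≡.trans (index-cong (trans (f-cong (elem∘index _)) (fg _))) (index∘elem i)

  module Σ+ = Sum +-commutativeMonoid
  module Π* = Sum *-commutativeMonoid
  open MonoidMult +-monoid using () renaming (_×_ to _×ₙ_)

  -- Translation by 1 permutes the field, so raising every summand by 1 leaves the sum of all
  -- elements unchanged, although it adds n copies of 1.
  order-×-1≈0 : n ×ₙ 1# ≈ 0#
  order-×-1≈0 = GroupProperties.identityˡ-unique +-group _ _ (begin
    n ×ₙ 1# + Σ+.sum elem                     ≈⟨ +-congʳ (Σ+.sum-replicate n) ⟨
    Σ+.sum {n} (λ _ → 1#) + Σ+.sum elem       ≈⟨ Σ+.∑-distrib-+ {n} (λ _ → 1#) elem ⟨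
    Σ+.sum (λ i → 1# + elem i)                ≈⟨ Σ+.sum-cong-≋ (λ i → sym (elem∘index (1# + elem i))) ⟩
    Σ+.sum (λ i → elem (index (1# + elem i))) ≈⟨ Σ+.sum-permute elem shift ⟨
    Σ+.sum elem                               ∎)
    where
    shift : Permutation′ n
    shift = transport (1# +_) (- 1# +_) +-congˡ +-congˡ
      (λ x → trans (sym (+-assoc _ _ _)) (trans (+-congʳ (-‿inverseʳ 1#)) (+-identityˡ x)))
      (λ x → trans (sym (+-assoc _ _ _)) (trans (+-congʳ (-‿inverseˡ 1#)) (+-identityˡ x)))

  Π*≉0 : ∀ {m} (t : Fin m → Carrier) → (∀ i → ¬ (t i ≈ 0#)) → ¬ (Π*.sum t ≈ 0#)
  Π*≉0 {zero}  t t≉0 = 1≉0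
  Π*≉0 {suc m} t t≉0 = *-≉0 (t≉0 zero) (Π*≉0 (t ∘ suc) (t≉0 ∘ suc))

  Π*-const : ∀ {m} {t : Fin m → Carrier} {a} → (∀ i → t i ≈ a) → Π*.sum t ≈ pow a m
  Π*-const {zero}  t≈a = refl
  Π*-const {suc m} t≈a = *-cong (t≈a zero) (Π*-const (t≈a ∘ suc))

  at0 : Carrier → Carrier → Carrier → Carrier
  at0 u v x with x ≟ 0#
  ... | yes _ = u
  ... | no  _ = v

  at0-zero : ∀ {u v x} → x ≈ 0# → at0 u v x ≈ u
  at0-zero {x = x} x≈0 with x ≟ 0#
  ... | yes _   = refl
  ... | no  x≉0 = contradiction x≈0 x≉0

  at0-nonzero : ∀ {u v x} → ¬ (x ≈ 0#) → at0 u v x ≈ v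
  at0-nonzero {x = x} x≉0 with x ≟ 0#
  ... | yes x≈0 = contradiction x≈0 x≉0
  ... | no  _   = refl

  -- Multiplication by a nonzero a permutes the field. Comparing the product of `f` before and after
  -- this permutation shows that the product of `g` is 1, and `g` takes the value a at all elements
  -- but 0.
  pow-order : ∀ x → pow x n ≈ x
  pow-order x = go ≡.refl x
    where
    -- The equation exposes the order as zero or a successor: order 0 is absurd since `index a`
    -- would inhabit an empty type, and for a successor `pow a m` is the power to exponent n - 1.
    go : ∀ {m} → m ≡ n → ∀ a → pow a m ≈ a
    go {zero}  ≡.refl a with () ← index a
    go {suc m} ≡.refl a with a ≟ 0#
    ... | yes a≈0 = trans (*-congʳ a≈0) (trans (zeroˡ _) (sym a≈0))
    ... | no  a≉0 = trans (*-congˡ powa≈1) (*-identityʳ a)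
      where
      -- Replacing the factor 0 by 1 turns the product of all elements into a nonzero one.
      f g : Carrier → Carrier
      f x = at0 1# x x
      g x = at0 1# a x

      f≉0 : ∀ x → ¬ (f x ≈ 0#)
      f≉0 x with x ≟ 0#
      ... | yes _   = 1≉0
      ... | no  x≉0 = x≉0

      f-* : ∀ x → f (elem (index (a * x))) ≈ g x * f x
      f-* x with x ≟ 0#
      ... | yes x≈0 = trans (at0-zero (trans (elem∘index _) (trans (*-congˡ x≈0) (zeroʳ a)))) (sym (*-identityˡ 1#))
      ... | no  x≉0 = trans (at0-nonzero (λ eq → *-≉0 a≉0 x≉0 (trans (sym (elem∘index _)) eq))) (elem∘index _)

      scale : Permutation′ n
      scale = transport (a *_) (1/ a a≉0 *_) *-congˡ *-congˡ
        (λ x → trans (sym (*-assoc _ _ _)) (trans (*-congʳ (1/-inverseʳ a a≉0)) (*-identityˡ x)))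
        (λ x → trans (sym (*-assoc _ _ _)) (trans (*-congʳ (trans (*-comm _ _) (1/-inverseʳ a a≉0))) (*-identityˡ x)))

      Πg≈1 : Π*.sum (g ∘ elem) ≈ 1#
      Πg≈1 = *-cancelˡ (Π*≉0 (f ∘ elem) (f≉0 ∘ elem)) (begin
        Π*.sum (f ∘ elem) * Π*.sum (g ∘ elem)         ≈⟨ *-comm _ _ ⟩
        Π*.sum (g ∘ elem) * Π*.sum (f ∘ elem)         ≈⟨ Π*.∑-distrib-+ (g ∘ elem) (f ∘ elem) ⟨
        Π*.sum (λ i → g (elem i) * f (elem i))        ≈⟨ Π*.sum-cong-≋ (f-* ∘ elem) ⟨
        Π*.sum (λ i → f (elem (index (a * elem i))))  ≈⟨ Π*.sum-permute (f ∘ elem) scale ⟨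
        Π*.sum (f ∘ elem)                             ≈⟨ *-identityʳ _ ⟨
        Π*.sum (f ∘ elem) * 1#                        ∎)

      i₀ : Fin (suc m)
      i₀ = index 0#

      powa≈1 : pow a m ≈ 1#
      powa≈1 = begin
        pow a m                                            ≈⟨ Π*-const g≈a ⟨
        Π*.sum (λ j → g (elem (punchIn i₀ j)))             ≈⟨ *-identityˡ _ ⟨
        1# * Π*.sum (λ j → g (elem (punchIn i₀ j)))        ≈⟨ *-congʳ (at0-zero (elem∘index 0#)) ⟨
        g (elem i₀) * Π*.sum (λ j → g (elem (punchIn i₀ j))) ≈⟨ Π*.sum-remove {i = i₀} (g ∘ elem) ⟨
        Π*.sum (g ∘ elem)                                  ≈⟨ Πg≈1 ⟩
        1#                                                 ∎
        where
        g≈a : ∀ j → g (elem (punchIn i₀ j)) ≈ a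
        g≈a j = at0-nonzero λ eq → Fin.punchInᵢ≢i i₀ j
          (≡.trans (≡.sym (index∘elem _)) (index-cong eq))

  -- If 1 + 1 were nonzero, then so would be 2^k copies of 1, which equal the k-th power of 1 + 1;
  -- but the order of the field annihilates 1.
  char2 : ∀ k → n ≡ 2 ℕ.^ k → 1# + 1# ≈ 0#
  char2 k ≡.refl with (1# + 1#) ≟ 0#
  ... | yes 2≈0 = 2≈0
  ... | no  2≉0 = contradiction order-×-1≈0 (nonzero k)
    where
    nonzero : ∀ j → ¬ ((2 ℕ.^ j) ×ₙ 1# ≈ 0#)
    nonzero zero    eq = 1≉0 (trans (sym (+-identityʳ 1#)) eq)
    nonzero (suc j) eq = *-≉0 (λ 2≈0 → 2≉0 (trans (+-congˡ (sym (+-identityʳ 1#))) 2≈0)) (nonzero j)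
      (trans (sym (SemiringMult.×1-homo-* semiring 2 (2 ℕ.^ j))) eq)

-- Algebra in characteristic 2: polynomial functions, iterated squaring, absolute trace

module Char2 {c ℓ} (K : Field c ℓ) (2≈0 : Characteristic2 K) where
  open Field K hiding (zero)
  open FieldProperties K
  open Over K using (pow)
  open SetoidReasoning setoid

  x+x≈0 : ∀ x → x + x ≈ 0#
  x+x≈0 x = begin
    x + x            ≈⟨ +-cong (*-identityʳ x) (*-identityʳ x) ⟨
    x * 1# + x * 1#  ≈⟨ distribˡ x 1# 1# ⟨
    x * (1# + 1#)    ≈⟨ *-congˡ 2≈0 ⟩
    x * 0#           ≈⟨ zeroʳ x ⟩
    0#               ∎

  -- In characteristic 2 the ring solver works with coefficients in F₂.
  𝔽₂ : RawRing _ _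
  𝔽₂ = record { Carrier = Bool ; _≈_ = _≡_ ; _+_ = _xor_ ; _*_ = _∧_ ; -_ = id ; 0# = false ; 1# = true }

  ⟦_⟧₂ : Bool → Carrier
  ⟦ false ⟧₂ = 0#
  ⟦ true  ⟧₂ = 1#

  ⟦⟧₂-+ : ∀ a b → ⟦ a xor b ⟧₂ ≈ ⟦ a ⟧₂ + ⟦ b ⟧₂
  ⟦⟧₂-+ false b     = sym (+-identityˡ _)
  ⟦⟧₂-+ true  false = sym (+-identityʳ _)
  ⟦⟧₂-+ true  true  = sym 2≈0

  ⟦⟧₂-* : ∀ a b → ⟦ a ∧ b ⟧₂ ≈ ⟦ a ⟧₂ * ⟦ b ⟧₂
  ⟦⟧₂-* false b = sym (zeroˡ _)
  ⟦⟧₂-* true  b = sym (*-identityˡ _)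

  private
    almostRing : AlmostCommutativeRing c ℓ
    almostRing = fromCommutativeSemiring commutativeSemiring

    ⟦⟧₂-homo : 𝔽₂ -Raw-AlmostCommutative⟶ almostRing
    ⟦⟧₂-homo = record
      { ⟦_⟧ = ⟦_⟧₂ ; +-homo = ⟦⟧₂-+ ; *-homo = ⟦⟧₂-* ; -‿homo = λ _ → refl ; 0-homo = refl ; 1-homo = refl }

    _≟₂_ : ∀ a b → Maybe (⟦ a ⟧₂ ≈ ⟦ b ⟧₂)
    false ≟₂ false = just refl
    true  ≟₂ true  = just refl
    _     ≟₂ _     = nothing

  open RingSolver 𝔽₂ almostRing ⟦⟧₂-homo _≟₂_ public
    using (solve; _:+_; _:*_; _:=_; con)

  ≈⇒+≈0 : ∀ {x y} → x ≈ y → x + y ≈ 0#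
  ≈⇒+≈0 {y = y} x≈y = trans (+-congʳ x≈y) (x+x≈0 y)

  +≈0⇒≈ : ∀ {x y} → x + y ≈ 0# → x ≈ y
  +≈0⇒≈ {x} {y} x+y≈0 = begin
    x            ≈⟨ solve 2 (λ x y → x := x :+ y :+ y) refl x y ⟩
    x + y + y    ≈⟨ +-congʳ x+y≈0 ⟩
    0# + y       ≈⟨ +-identityˡ y ⟩
    y            ∎

  -- The multipliers are a certificate that l + r lies in the ideal generated by the sums l₁ + r₁,
  -- ...; checking it is a polynomial identity left to the ring solver. Sums stand for differences
  -- in characteristic 2.
  linear₁ : ∀ {l r l₁ r₁} m₁ → l₁ ≈ r₁ → l + r ≈ m₁ * (l₁ + r₁) → l ≈ r
  linear₁ m₁ e₁ eq = +≈0⇒≈ (trans eq (trans (*-congˡ (≈⇒+≈0 e₁)) (zeroʳ m₁)))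

  linear₂ : ∀ {l r l₁ r₁ l₂ r₂} m₁ m₂ → l₁ ≈ r₁ → l₂ ≈ r₂ →
            l + r ≈ m₁ * (l₁ + r₁) + m₂ * (l₂ + r₂) → l ≈ r
  linear₂ m₁ m₂ e₁ e₂ eq = +≈0⇒≈ (trans eq (trans
    (+-cong (trans (*-congˡ (≈⇒+≈0 e₁)) (zeroʳ m₁)) (trans (*-congˡ (≈⇒+≈0 e₂)) (zeroʳ m₂))) (+-identityʳ 0#)))

  linear₃ : ∀ {l r l₁ r₁ l₂ r₂ l₃ r₃} m₁ m₂ m₃ → l₁ ≈ r₁ → l₂ ≈ r₂ → l₃ ≈ r₃ →
            l + r ≈ m₁ * (l₁ + r₁) + m₂ * (l₂ + r₂) + m₃ * (l₃ + r₃) → l ≈ r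
  linear₃ m₁ m₂ m₃ e₁ e₂ e₃ eq = +≈0⇒≈ (trans eq (trans
    (+-cong (+-cong (trans (*-congˡ (≈⇒+≈0 e₁)) (zeroʳ m₁)) (trans (*-congˡ (≈⇒+≈0 e₂)) (zeroʳ m₂)))
      (trans (*-congˡ (≈⇒+≈0 e₃)) (zeroʳ m₃)))
    (trans (+-congʳ (+-identityʳ 0#)) (+-identityʳ 0#))))

  -- Polynomial functions of degree d with leading coefficient a, in a form adapted to root counting:
  -- f x − f r is divisible by x − r with a quotient of the same kind.
  IsPoly : Carrier → ℕ → (Carrier → Carrier) → Set (c ⊔ ℓ)
  IsPoly a zero    f = Level.Lift c (∀ x → f x ≈ a)
  IsPoly a (suc d) f = ∀ r → Σ (Carrier → Carrier) λ g → IsPoly a d g × (∀ x → f x ≈ f r + (x + r) * g x)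

  poly-resp : ∀ {a f g} d → (∀ x → f x ≈ g x) → IsPoly a d f → IsPoly a d g
  poly-resp zero    f≈g (Level.lift p) = Level.lift λ x → trans (sym (f≈g x)) (p x)
  poly-resp (suc d) f≈g p r with g , pg , eq ← p r =
    g , pg , λ x → trans (sym (f≈g x)) (trans (eq x) (+-congʳ (f≈g r)))

  poly-coeff : ∀ {a b f} d → a ≈ b → IsPoly a d f → IsPoly b d f
  poly-coeff zero    a≈b (Level.lift p) = Level.lift λ x → trans (p x) a≈b
  poly-coeff (suc d) a≈b p r with g , pg , eq ← p r = g , poly-coeff d a≈b pg , eq

  poly-+ : ∀ {a b f g} d → IsPoly a d f → IsPoly b d g → IsPoly (a + b) d (λ x → f x + g x)
  poly-+ zero (Level.lift p) (Level.lift q) = Level.lift λ x → +-cong (p x) (q x)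
  poly-+ (suc d) p q r with f′ , pf , eqf ← p r | g′ , pg , eqg ← q r =
    _ , poly-+ d pf pg , λ x → trans (+-cong (eqf x) (eqg x))
      (solve 5 (λ fr gr s u v → (fr :+ s :* u) :+ (gr :+ s :* v) := (fr :+ gr) :+ s :* (u :+ v)) refl _ _ (x + r) _ _)

  poly-scale : ∀ {a f} b d → IsPoly a d f → IsPoly (b * a) d (λ x → b * f x)
  poly-scale b zero (Level.lift p) = Level.lift λ x → *-congˡ (p x)
  poly-scale b (suc d) p r with f′ , pf , eqf ← p r =
    _ , poly-scale b d pf , λ x → trans (*-congˡ (eqf x))
      (solve 4 (λ b fr s u → b :* (fr :+ s :* u) := b :* fr :+ s :* (b :* u)) refl b _ (x + r) _)

  -- The degree in `IsPoly` is formal, so a function of lower degree must be lifted, with leading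
  -- coefficient 0, before it is added to one of higher degree.
  poly-raise : ∀ {a f} d → IsPoly a d f → IsPoly 0# (suc d) f
  poly-raise {a} {f} zero (Level.lift p) r = (λ _ → 0#) , Level.lift (λ _ → refl) , λ x → begin
    f x                    ≈⟨ trans (p x) (sym (p r)) ⟩
    f r                    ≈⟨ solve 2 (λ u v → u := u :+ v :* con false) refl _ _ ⟩
    f r + (x + r) * 0#     ∎
  poly-raise (suc d) p r with g , pg , eq ← p r = g , poly-raise d pg , eq

  poly-raise-< : ∀ {f d e} → IsPoly 0# d f → d ℕ.≤ e → IsPoly 0# e f
  poly-raise-< {f} p d≤e = go p (ℕ.≤⇒≤′ d≤e)
    where
    go : ∀ {d e} → IsPoly 0# d f → d ℕ.≤′ e → IsPoly 0# e f
    go p ℕ.≤′-refl        = p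
    go p (ℕ.≤′-step d≤e) = poly-raise _ (go p d≤e)

  -- From x f(x) - r f(r) = (x - r) f(x) + r (f(x) - f(r)), the new quotient is f(x) + r g(x), and
  -- its second summand has lower degree.
  poly-x* : ∀ {a f} d → IsPoly a d f → IsPoly a (suc d) (λ x → x * f x)
  poly-x* {f = f} zero (Level.lift p) r = f , Level.lift p , λ x → begin
    x * f x                  ≈⟨ solve 3 (λ x r u → x :* u := r :* u :+ (x :+ r) :* u) refl x r (f x) ⟩
    r * f x + (x + r) * f x  ≈⟨ +-congʳ (*-congˡ (trans (p x) (sym (p r)))) ⟩
    r * f r + (x + r) * f x  ∎
  poly-x* {f = f} (suc d) p r with g , pg , eq ← p r =
    (λ x → f x + r * g x) ,
    poly-coeff (suc d) (+-identityʳ _) (poly-+ (suc d) p (poly-coeff (suc d) (zeroʳ r) (poly-scale r (suc d) (poly-raise d pg)))) ,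
    λ x → linear₁ r (eq x)
      (solve 5 (λ x r fx fr gx → x :* fx :+ (r :* fr :+ (x :+ r) :* (fx :+ r :* gx))
                              := r :* (fx :+ (fr :+ (x :+ r) :* gx))) refl x r (f x) (f r) (g x))

  poly-pow : ∀ n → IsPoly 1# n (λ x → pow x n)
  poly-pow zero    = Level.lift λ _ → refl
  poly-pow (suc n) = poly-x* n (poly-pow n)

  -- Dividing by x - e₀ leaves a quotient with the same leading coefficient that vanishes at the
  -- remaining points; at degree 0 the value is the leading coefficient itself.
  too-many-roots : ∀ {a f} d → IsPoly a d f → (e : Fin (suc d) → Carrier) → (∀ {i j} → e i ≈ e j → i ≡ j) →
                   (∀ i → f (e i) ≈ 0#) → a ≈ 0#
  too-many-roots zero (Level.lift p) e e-inj fe≈0 = trans (sym (p (e zero))) (fe≈0 zero)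
  too-many-roots {f = f} (suc d) p e e-inj fe≈0 with g , pg , eq ← p (e zero) =
    too-many-roots d pg (e ∘ suc) (Fin.suc-injective ∘ e-inj) λ i →
      xy≈0⇒y≈0 (λ e+e≈0 → Fin.0≢1+n (≡.sym (e-inj (+≈0⇒≈ e+e≈0)))) (begin
        (e (suc i) + e zero) * g (e (suc i))              ≈⟨ +-identityˡ _ ⟨
        0# + (e (suc i) + e zero) * g (e (suc i))         ≈⟨ +-congʳ (fe≈0 zero) ⟨
        f (e zero) + (e (suc i) + e zero) * g (e (suc i)) ≈⟨ eq (e (suc i)) ⟨
        f (e (suc i))                                     ≈⟨ fe≈0 (suc i) ⟩
        0#                                                ∎)

  frob : ℕ → Carrier → Carrier
  frob zero    x = x
  frob (suc k) x = frob k (x * x)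

  frob-cong : ∀ k {x y} → x ≈ y → frob k x ≈ frob k y
  frob-cong zero    x≈y = x≈y
  frob-cong (suc k) x≈y = frob-cong k (*-cong x≈y x≈y)

  frob-+ : ∀ k x y → frob k (x + y) ≈ frob k x + frob k y
  frob-+ zero    x y = refl
  frob-+ (suc k) x y = trans
    (frob-cong k (solve 2 (λ x y → (x :+ y) :* (x :+ y) := x :* x :+ y :* y) refl x y)) (frob-+ k _ _)

  frob-* : ∀ k x y → frob k (x * y) ≈ frob k x * frob k y
  frob-* zero    x y = refl
  frob-* (suc k) x y = trans
    (frob-cong k (solve 2 (λ x y → (x :* y) :* (x :* y) := (x :* x) :* (y :* y)) refl x y)) (frob-* k _ _)

  frob-1 : ∀ k → frob k 1# ≈ 1#
  frob-1 zero    = refl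
  frob-1 (suc k) = trans (frob-cong k (*-identityˡ 1#)) (frob-1 k)

  frob-0 : ∀ k → frob k 0# ≈ 0#
  frob-0 zero    = refl
  frob-0 (suc k) = trans (frob-cong k (zeroˡ 0#)) (frob-0 k)

  frob-∘ : ∀ j k x → frob (j ℕ.+ k) x ≡ frob k (frob j x)
  frob-∘ zero    k x = ≡.refl
  frob-∘ (suc j) k x = frob-∘ j k (x * x)

  frob-fix-* : ∀ m {x} → frob m x ≈ x → ∀ j → frob (j ℕ.* m) x ≈ x
  frob-fix-* m fix zero    = refl
  frob-fix-* m {x} fix (suc j) = begin
    frob (m ℕ.+ j ℕ.* m) x      ≡⟨ frob-∘ m (j ℕ.* m) x ⟩
    frob (j ℕ.* m) (frob m x)   ≈⟨ frob-cong (j ℕ.* m) fix ⟩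
    frob (j ℕ.* m) x            ≈⟨ frob-fix-* m fix j ⟩
    x                           ∎

  -- On an element of the field with 2^m elements, the exponent of the Frobenius matters only modulo
  -- m.
  frob-mod : ∀ m {x} → frob m x ≈ x → ∀ {h} r j → h ≡ r ℕ.+ j ℕ.* m → frob h x ≈ frob r x
  frob-mod m {x} fix {h} r j h≡ = begin
    frob h x                    ≡⟨ ≡.cong (λ i → frob i x) (≡.trans h≡ (ℕ.+-comm r (j ℕ.* m))) ⟩
    frob (j ℕ.* m ℕ.+ r) x      ≡⟨ frob-∘ (j ℕ.* m) r x ⟩
    frob r (frob (j ℕ.* m) x)   ≈⟨ frob-cong r (frob-fix-* m fix j) ⟩
    frob r x                    ∎

  open Exp semiring using (^-assocʳ) renaming (_^_ to _^ˢ_)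

  pow≡^ˢ : ∀ x n → pow x n ≡ x ^ˢ n
  pow≡^ˢ x zero    = ≡.refl
  pow≡^ˢ x (suc n) = ≡.cong (x *_) (pow≡^ˢ x n)

  pow-cong : ∀ n {x y} → x ≈ y → pow x n ≈ pow y n
  pow-cong zero    x≈y = refl
  pow-cong (suc n) x≈y = *-cong x≈y (pow-cong n x≈y)

  pow-* : ∀ x m n → pow x (m ℕ.* n) ≈ pow (pow x m) n
  pow-* x m n = begin
    pow x (m ℕ.* n)     ≡⟨ pow≡^ˢ x (m ℕ.* n) ⟩
    x ^ˢ (m ℕ.* n)       ≈⟨ ^-assocʳ x m n ⟨
    (x ^ˢ m) ^ˢ n         ≡⟨ pow≡^ˢ (x ^ˢ m) n ⟨
    pow (x ^ˢ m) n       ≡⟨ ≡.cong (λ y → pow y n) (pow≡^ˢ x m) ⟨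
    pow (pow x m) n     ∎

  pow-2^ : ∀ k x → pow x (2 ℕ.^ k) ≈ frob k x
  pow-2^ zero    x = *-identityʳ x
  pow-2^ (suc k) x = begin
    pow x (2 ℕ.* 2 ℕ.^ k)      ≈⟨ pow-* x 2 (2 ℕ.^ k) ⟩
    pow (pow x 2) (2 ℕ.^ k)    ≈⟨ pow-2^ k _ ⟩
    frob k (x * (x * 1#))      ≈⟨ frob-cong k (*-congˡ (*-identityʳ x)) ⟩
    frob k (x * x)             ∎

  Tr : ℕ → Carrier → Carrier
  Tr zero    x = 0#
  Tr (suc k) x = x + Tr k (x * x)

  Tr-cong : ∀ k {x y} → x ≈ y → Tr k x ≈ Tr k y
  Tr-cong zero    x≈y = refl
  Tr-cong (suc k) x≈y = +-cong x≈y (Tr-cong k (*-cong x≈y x≈y))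

  Tr-∘ : ∀ j k x → Tr (j ℕ.+ k) x ≈ Tr j x + Tr k (frob j x)
  Tr-∘ zero    k x = sym (+-identityˡ _)
  Tr-∘ (suc j) k x = trans (+-congˡ (Tr-∘ j k (x * x))) (sym (+-assoc _ _ _))

  Tr-suc : ∀ k x → Tr (suc k) x ≈ Tr k x + frob k x
  Tr-suc zero    x = +-comm _ _
  Tr-suc (suc k) x = trans (+-congˡ (Tr-suc k (x * x))) (sym (+-assoc _ _ _))

  Tr-+ : ∀ k x y → Tr k (x + y) ≈ Tr k x + Tr k y
  Tr-+ zero    x y = sym (+-identityˡ _)
  Tr-+ (suc k) x y = begin
    x + y + Tr k ((x + y) * (x + y))
      ≈⟨ +-congˡ (Tr-cong k (solve 2 (λ x y → (x :+ y) :* (x :+ y) := x :* x :+ y :* y) refl x y)) ⟩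
    x + y + Tr k (x * x + y * y)
      ≈⟨ +-congˡ (Tr-+ k _ _) ⟩
    x + y + (Tr k (x * x) + Tr k (y * y))
      ≈⟨ solve 4 (λ x y u v → x :+ y :+ (u :+ v) := (x :+ u) :+ (y :+ v)) refl x y _ _ ⟩
    x + Tr k (x * x) + (y + Tr k (y * y)) ∎

  Tr-0 : ∀ k → Tr k 0# ≈ 0#
  Tr-0 zero    = refl
  Tr-0 (suc k) = trans (+-identityˡ _) (trans (Tr-cong k (zeroˡ 0#)) (Tr-0 k))

  Tr-sq : ∀ k x → Tr k (x * x) ≈ Tr k x * Tr k x
  Tr-sq zero    x = sym (zeroˡ 0#)
  Tr-sq (suc k) x = trans (+-congˡ (Tr-sq k (x * x)))
    (solve 2 (λ x t → x :* x :+ t :* t := (x :+ t) :* (x :+ t)) refl x _)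

  -- For an element of the field with 2^m elements, the trace sum of length j m is j copies of the
  -- one of length m.
  Tr-period : ∀ m {x} → frob m x ≈ x → Tr m x ≈ 0# → ∀ j → Tr (j ℕ.* m) x ≈ 0#
  Tr-period m fix tr zero    = refl
  Tr-period m {x} fix tr (suc j) = begin
    Tr (m ℕ.+ j ℕ.* m) x              ≈⟨ Tr-∘ m (j ℕ.* m) x ⟩
    Tr m x + Tr (j ℕ.* m) (frob m x)  ≈⟨ +-cong tr (Tr-cong (j ℕ.* m) fix) ⟩
    0# + Tr (j ℕ.* m) x               ≈⟨ +-identityˡ _ ⟩
    Tr (j ℕ.* m) x                    ≈⟨ Tr-period m fix tr j ⟩
    0#                                ∎

  poly-frob : ∀ k → IsPoly 1# (2 ℕ.^ k) (frob k)
  poly-frob k = poly-resp (2 ℕ.^ k) (pow-2^ k) (poly-pow (2 ℕ.^ k))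

  2^k<2^[1+k] : ∀ k → 2 ℕ.^ k ℕ.< 2 ℕ.^ suc k
  2^k<2^[1+k] k = ℕ.^-monoʳ-< 2 (ℕ.s≤s (ℕ.s≤s ℕ.z≤n)) (ℕ.n<1+n k)

  mutual
    -- The true degree is at most half of 2^k. The strict inequality pays for the one raising step
    -- that turns the leading coefficient into 0.
    poly-Tr : ∀ k → IsPoly 0# (2 ℕ.^ k) (Tr k)
    poly-Tr zero    = poly-raise zero (Level.lift λ _ → refl)
    poly-Tr (suc k) = poly-raise-< (poly-raise (2 ℕ.^ k) (poly-Tr-suc k)) (2^k<2^[1+k] k)

    poly-Tr-suc : ∀ k → IsPoly 1# (2 ℕ.^ k) (Tr (suc k))
    poly-Tr-suc k = poly-resp (2 ℕ.^ k) (sym ∘ Tr-suc k)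
      (poly-coeff (2 ℕ.^ k) (+-identityˡ 1#) (poly-+ (2 ℕ.^ k) (poly-Tr k) (poly-frob k)))

  -- Squaring a adds e, so each further squaring adds the next conjugate of e. A root of X² + X + e
  -- is therefore fixed by `frob k` as soon as `Tr k e` vanishes.
  frob-root : ∀ {a e} → a * a + a ≈ e → ∀ k → frob k a ≈ a + Tr k e
  frob-root {a} {e} eq zero    = sym (+-identityʳ a)
  frob-root {a} {e} eq (suc k) = begin
    frob k (a * a)           ≈⟨ frob-cong k (linear₁ 1# eq (solve 2 (λ a e → a :* a :+ (a :+ e) := con true :* (a :* a :+ a :+ e)) refl a e)) ⟩
    frob k (a + e)           ≈⟨ frob-+ k a e ⟩
    frob k a + frob k e      ≈⟨ +-congʳ (frob-root eq k) ⟩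
    a + Tr k e + frob k e    ≈⟨ +-assoc _ _ _ ⟩
    a + (Tr k e + frob k e)  ≈⟨ +-congˡ (Tr-suc k e) ⟨
    a + Tr (suc k) e         ∎

  -- Squaring shifts the trace sum by one place; the sum changes by x and `frob n x`, which cancel.
  -- Hence a nonzero trace must be 1.
  Tr-idem : ∀ n {x} → frob n x ≈ x → Tr n x * Tr n x ≈ Tr n x
  Tr-idem n {x} fix = trans (sym (Tr-sq n x)) (linear₂ 1# 1# (Tr-suc n x) fix
    (solve 4 (λ x t u v → u :+ t := con true :* (x :+ u :+ (t :+ v)) :+ con true :* (v :+ x)) refl
      x (Tr n x) (Tr n (x * x)) (frob n x)))

  -- Additive Hilbert 90: with Tr θ = 1, the solution is Σᵢ (c + c² + … + c^(2^(i-1))) θ^(2^i).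
  artin-schreier : ∀ n {θ} → frob n θ ≈ θ → Tr n θ ≈ 1# → ∀ c → Tr n c ≈ 0# → Σ Carrier λ x → x * x + x ≈ c
  artin-schreier n {θ} fix Tr-θ≈1 c Tr-c≈0 = partial n , (begin
      partial n * partial n + partial n
        ≈⟨ partial-eq n ⟩
      Tr n c * frob n θ + c * (Tr n θ + frob n θ + θ)
        ≈⟨ +-cong (*-congʳ Tr-c≈0) (*-congˡ (+-congʳ (+-cong Tr-θ≈1 fix))) ⟩
      0# * frob n θ + c * (1# + θ + θ)
        ≈⟨ solve 3 (λ u c θ → con false :* u :+ c :* (con true :+ θ :+ θ) := c) refl (frob n θ) c θ ⟩
      c ∎)
    where
    partial : ℕ → Carrier
    partial zero    = 0#
    partial (suc i) = partial i + Tr i c * frob i θ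

    frob-suc : ∀ i → frob (suc i) θ ≈ frob i θ * frob i θ
    frob-suc i = frob-* i θ θ

    -- Squaring sends each term to the next one up to a multiple of c, since `Tr (suc i) c` is c
    -- plus the square of `Tr i c`. The sum therefore telescopes, and at i = n the boundary terms
    -- collapse to c.
    partial-eq : ∀ i → partial i * partial i + partial i ≈ Tr i c * frob i θ + c * (Tr i θ + frob i θ + θ)
    partial-eq zero = solve 2 (λ c θ → con false :* con false :+ con false
      := con false :* θ :+ c :* (con false :+ θ :+ θ)) refl c θ
    partial-eq (suc i) = begin
      (a + s * f) * (a + s * f) + (a + s * f)
        ≈⟨ linear₁ 1# (partial-eq i) (solve 6 (λ a s f c t θ →
             (a :+ s :* f) :* (a :+ s :* f) :+ (a :+ s :* f) :+ ((c :+ s :* s) :* (f :* f) :+ c :* (t :+ f :+ f :* f :+ θ))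
             := con true :* (a :* a :+ a :+ (s :* f :+ c :* (t :+ f :+ θ)))) refl a s f c (Tr i θ) θ) ⟩
      (c + s * s) * (f * f) + c * (Tr i θ + f + f * f + θ)
        ≈⟨ +-cong (*-cong (+-congˡ (Tr-sq i c)) (frob-suc i)) (*-congˡ (+-congʳ (+-cong (Tr-suc i θ) (frob-suc i)))) ⟨
      Tr (suc i) c * frob (suc i) θ + c * (Tr (suc i) θ + frob (suc i) θ + θ) ∎
      where
      a s f : Carrier
      a = partial i
      s = Tr i c
      f = frob i θ

  -- An element of trace 1

  module Order {k} (order : HasOrder K (2 ℕ.^ suc k)) where
    open FiniteField K order

    frob-order : ∀ x → frob (suc k) x ≈ x
    frob-order x = trans (sym (pow-2^ (suc k) x)) (pow-order x)

    -- The trace is monic of degree 2^k, so it cannot vanish at 2^k + 1 of the 2^(k+1) elements.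
    Tr≢0 : ¬ (∀ i → Tr (suc k) (elem i) ≈ 0#)
    Tr≢0 Tr≈0 = 1≉0 (too-many-roots (2 ℕ.^ k) (poly-Tr-suc k) (λ i → elem (inject≤ i (2^k<2^[1+k] k)))
      (Fin.inject≤-injective _ _ _ _ ∘ elem-injective) (λ i → Tr≈0 _))

    Tr≈1 : Σ Carrier λ θ → Tr (suc k) θ ≈ 1#
    Tr≈1 with i , Tr≉0 ← Fin.¬∀⟶∃¬ _ (λ i → Tr (suc k) (elem i) ≈ 0#) (λ i → Tr (suc k) (elem i) ≟ 0#) Tr≢0 =
      elem i , *-cancelˡ Tr≉0 (trans (Tr-idem (suc k) (frob-order (elem i))) (sym (*-identityʳ _)))

-- Collects the properties of x ↦ x^q used by the algebra below; F_q becomes the set of fixed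
-- points.
record Automorphism {c ℓ} (K : Field c ℓ) : Set (c ⊔ ℓ) where
  open Field K
  field
    σ      : Carrier → Carrier
    σ-cong : ∀ {x y} → x ≈ y → σ x ≈ σ y
    σ-+    : ∀ x y → σ (x + y) ≈ σ x + σ y
    σ-*    : ∀ x y → σ (x * y) ≈ σ x * σ y
    σ-1    : σ 1# ≈ 1#
    σ⁴     : ∀ x → σ (σ (σ (σ x))) ≈ x

-- Lines that meet U in two vectors whose ratio l lies outside F_q

module Order4 {c ℓ} (K : Field c ℓ) (2≈0 : Characteristic2 K)
              (A : Automorphism K) where
  open Field K hiding (zero)
  open FieldProperties K
  open Char2 K 2≈0
  open Automorphism A
  open SetoidReasoning setoid

  σ-0 : σ 0# ≈ 0#
  σ-0 = begin
    σ 0#           ≈⟨ σ-cong (+-identityʳ 0#) ⟨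
    σ (0# + 0#)    ≈⟨ σ-+ 0# 0# ⟩
    σ 0# + σ 0#    ≈⟨ x+x≈0 _ ⟩
    0#             ∎

  σ-≈0 : ∀ {x} → x ≈ 0# → σ x ≈ 0#
  σ-≈0 x≈0 = trans (σ-cong x≈0) σ-0

  σx≈0⇒x≈0 : ∀ {x} → σ x ≈ 0# → x ≈ 0#
  σx≈0⇒x≈0 σx≈0 = trans (sym (σ⁴ _)) (σ-≈0 (σ-≈0 (σ-≈0 σx≈0)))

  σ-≉0 : ∀ {x} → ¬ (x ≈ 0#) → ¬ (σ x ≈ 0#)
  σ-≉0 x≉0 σx≈0 = x≉0 (σx≈0⇒x≈0 σx≈0)

  -- If u σ(u) + u + 1 = 0 then σ acts on u by the Möbius map u ↦ (u + 1)/u, whose order 3 is prime to 4.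
  module Moebius (u : Carrier) (rel : u * σ u + u + 1# ≈ 0#) where
    private
      σ-rel : ∀ {w} → w * σ w + w + 1# ≈ 0# → σ w * σ (σ w) + σ w + 1# ≈ 0#
      σ-rel {w} eq = begin
        σ w * σ (σ w) + σ w + 1#    ≈⟨ +-cong (+-congʳ (σ-* w (σ w))) σ-1 ⟨
        σ (w * σ w) + σ w + σ 1#    ≈⟨ +-congʳ (σ-+ _ _) ⟨
        σ (w * σ w + w) + σ 1#      ≈⟨ σ-+ _ _ ⟨
        σ (w * σ w + w + 1#)        ≈⟨ σ-≈0 eq ⟩
        0#                          ∎

      -- Multiply the shifted relation by w and use w σ(w) + w = 1. Comparing the result at u and at
      -- σ u cancels to σ³ u = u.
      product≈1 : ∀ {w} → w * σ w + w + 1# ≈ 0# → σ w * σ (σ w) * w ≈ 1#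
      product≈1 {w} eq = linear₂ w 1# (σ-rel eq) eq
        (solve 3 (λ a b c → b :* c :* a :+ con true
           := a :* (b :* c :+ b :+ con true :+ con false) :+ con true :* (a :* b :+ a :+ con true :+ con false))
           refl w (σ w) (σ (σ w)))

      u≈σ³u : u ≈ σ (σ (σ u))
      u≈σ³u = *-cancelˡ σuσ²u≉0 (begin
        σ u * σ (σ u) * u                ≈⟨ product≈1 rel ⟩
        1#                               ≈⟨ product≈1 (σ-rel rel) ⟨
        σ (σ u) * σ (σ (σ u)) * σ u      ≈⟨ solve 3 (λ a b c → b :* c :* a := a :* b :* c) refl (σ u) (σ (σ u)) (σ (σ (σ u))) ⟩
        σ u * σ (σ u) * σ (σ (σ u))      ∎)
        where
        σuσ²u≉0 : ¬ (σ u * σ (σ u) ≈ 0#)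
        σuσ²u≉0 eq = 1≉0 (trans (sym (product≈1 rel)) (trans (*-congʳ eq) (zeroˡ u)))

    σu≈u : σ u ≈ u
    -- Being fixed by σ³ and by σ⁴, u is fixed by σ.
    σu≈u = trans (σ-cong u≈σ³u) (σ⁴ u)

    u²+u≈1 : u * u + u ≈ 1#
    u²+u≈1 = linear₂ 1# u rel σu≈u (solve 2 (λ u u₁ → u :* u :+ u :+ con true
      := con true :* (u :* u₁ :+ u :+ con true :+ con false) :+ u :* (u₁ :+ u)) refl u (σ u))

  module Line (l x y : Carrier) (l∉F : ¬ (σ l ≈ l)) (xy≉0 : ¬ (x ≈ 0# × y ≈ 0#))
    (e₁ : l * (σ x + σ (σ y)) ≈ σ (l * x) + σ (σ (l * y)))
    (e₂ : l * (σ (σ x) + σ y + σ (σ y)) ≈ σ (σ (l * x)) + σ (l * y) + σ (σ (l * y)))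
    where
    private
      x₁ x₂ y₁ y₂ y₃ a₀ a₁ a₂ a₃ b c′ P : Carrier
      x₁ = σ x
      x₂ = σ x₁
      y₁ = σ y
      y₂ = σ y₁
      y₃ = σ y₂
      a₀ = σ l + l
      a₁ = σ a₀
      a₂ = σ a₁
      a₃ = σ a₂
      b  = a₀ + a₁
      c′ = a₁ + a₂
      P  = b * c′

      σ²-* : ∀ x y → σ (σ (x * y)) ≈ σ (σ x) * σ (σ y)
      σ²-* x y = trans (σ-cong (σ-* x y)) (σ-* _ _)

      b≈σ²l+l : b ≈ σ (σ l) + l
      b≈σ²l+l = trans (+-congˡ (σ-+ (σ l) l))
        (solve 3 (λ l l₁ l₂ → l₁ :+ l :+ (l₂ :+ l₁) := l₂ :+ l) refl l (σ l) (σ (σ l)))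

      a₃≈ : a₃ ≈ a₀ + a₁ + a₂
      a₃≈ = begin
        σ (σ (σ (σ l + l)))             ≈⟨ trans (σ-cong (trans (σ-cong (σ-+ _ _)) (σ-+ _ _))) (σ-+ _ _) ⟩
        σ (σ (σ (σ l))) + σ (σ (σ l))   ≈⟨ +-congʳ (σ⁴ l) ⟩
        l + σ (σ (σ l))                 ≈⟨ solve 4 (λ l l₁ l₂ l₃ → l :+ l₃ := l₁ :+ l :+ (l₂ :+ l₁) :+ (l₃ :+ l₂))
                                             refl l (σ l) (σ (σ l)) (σ (σ (σ l))) ⟩
        a₀ + (σ (σ l) + σ l) + (σ (σ (σ l)) + σ (σ l))
          ≈⟨ +-cong (+-congˡ (σ-+ _ _)) (trans (σ-cong (σ-+ _ _)) (σ-+ _ _)) ⟨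
        a₀ + a₁ + a₂                    ∎

      σb≈c : σ b ≈ c′
      σb≈c = σ-+ a₀ a₁

      σc≈b : σ c′ ≈ b
      σc≈b = trans (σ-+ a₁ a₂) (trans (+-congˡ a₃≈)
        (solve 3 (λ a₀ a₁ a₂ → a₂ :+ (a₀ :+ a₁ :+ a₂) := a₀ :+ a₁) refl a₀ a₁ a₂))

      a₀x₁≈by₂ : a₀ * x₁ ≈ b * y₂
      a₀x₁≈by₂ = trans
        (linear₁ 1# (trans e₁ (+-cong (σ-* l x) (σ²-* l y)))
          (solve 5 (λ l l₁ l₂ x₁ y₂ → (l₁ :+ l) :* x₁ :+ (l₂ :+ l) :* y₂
            := con true :* (l :* (x₁ :+ y₂) :+ (l₁ :* x₁ :+ l₂ :* y₂))) refl l (σ l) (σ (σ l)) x₁ y₂))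
        (*-congʳ (sym b≈σ²l+l))

      bx₂+a₀y₁+by₂≈0 : b * x₂ + a₀ * y₁ + b * y₂ ≈ 0#
      bx₂+a₀y₁+by₂≈0 = trans (+-cong (+-congʳ (*-congʳ b≈σ²l+l)) (*-congʳ b≈σ²l+l))
        (linear₁ 1# (trans e₂ (+-cong (+-cong (σ²-* l x) (σ-* l y)) (σ²-* l y)))
          (solve 6 (λ l l₁ l₂ x₂ y₁ y₂ → (l₂ :+ l) :* x₂ :+ (l₁ :+ l) :* y₁ :+ (l₂ :+ l) :* y₂ :+ con false
            := con true :* (l :* (x₂ :+ y₁ :+ y₂) :+ (l₂ :* x₂ :+ l₁ :* y₁ :+ l₂ :* y₂)))
            refl l (σ l) (σ (σ l)) x₂ y₁ y₂))

      a₀≉0 : ¬ (a₀ ≈ 0#)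
      a₀≉0 a₀≈0 = l∉F (+≈0⇒≈ a₀≈0)

      -- Since `a₀` is nonzero, the first equation recovers x from b σ²(y). This drives the
      -- exclusion of y = 0 and of b = 0.
      by₂≈0⇒x≈0 : b * y₂ ≈ 0# → x ≈ 0#
      by₂≈0⇒x≈0 by₂≈0 = σx≈0⇒x≈0 (xy≈0⇒y≈0 a₀≉0 (trans a₀x₁≈by₂ by₂≈0))

      y≉0 : ¬ (y ≈ 0#)
      y≉0 y≈0 = xy≉0 (by₂≈0⇒x≈0 (trans (*-congˡ (σ-≈0 (σ-≈0 y≈0))) (zeroʳ b)) , y≈0)

      -- If l were fixed by σ², the first equation would force x = 0 and the second y = 0.
      b≉0 : ¬ (b ≈ 0#)
      b≉0 b≈0 = xy≉0 (by₂≈0⇒x≈0 (trans (*-congʳ b≈0) (zeroˡ y₂)) , σx≈0⇒x≈0 (xy≈0⇒y≈0 a₀≉0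
        (linear₂ 1# (x₂ + y₂) bx₂+a₀y₁+by₂≈0 b≈0
          (solve 5 (λ b x₂ a₀ y₁ y₂ → a₀ :* y₁ :+ con false
            := con true :* (b :* x₂ :+ a₀ :* y₁ :+ b :* y₂ :+ con false) :+ (x₂ :+ y₂) :* (b :+ con false))
            refl b x₂ a₀ y₁ y₂))))

      c≉0 : ¬ (c′ ≈ 0#)
      c≉0 c≈0 = σ-≉0 b≉0 (trans σb≈c c≈0)

      a₀y₁≉0 : ¬ (a₀ * y₁ ≈ 0#)
      a₀y₁≉0 = *-≉0 a₀≉0 (σ-≉0 y≉0)

    u : Carrier
    u = 1/ (a₀ * y₁) a₀y₁≉0 * (b * y₂)

    private
      a₀y₁u≈by₂ : a₀ * y₁ * u ≈ b * y₂
      a₀y₁u≈by₂ = trans (sym (*-assoc _ _ _)) (trans (*-congʳ (1/-inverseʳ _ a₀y₁≉0)) (*-identityˡ _))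

      σ-eq : ∀ {p q r s t} → p * q * r ≈ s * t → σ p * σ q * σ r ≈ σ s * σ t
      σ-eq {p} {q} {r} {s} {t} eq = begin
        σ p * σ q * σ r    ≈⟨ *-congʳ (σ-* p q) ⟨
        σ (p * q) * σ r    ≈⟨ σ-* _ _ ⟨
        σ (p * q * r)      ≈⟨ σ-cong eq ⟩
        σ (s * t)          ≈⟨ σ-* _ _ ⟩
        σ s * σ t          ∎

      a₁y₂σu≈cy₃ : a₁ * y₂ * σ u ≈ c′ * y₃
      a₁y₂σu≈cy₃ = trans (σ-eq a₀y₁u≈by₂) (*-congʳ σb≈c)

      -- Eliminates x: applying σ to the first equation expresses `a₁ * x₂` through y, and the
      -- second equation is multiplied by `a₁`.
      bcy₃+a₀a₁y₁+a₁by₂≈0 : b * (c′ * y₃) + a₁ * (a₀ * y₁) + a₁ * (b * y₂) ≈ 0#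
      bcy₃+a₀a₁y₁+a₁by₂≈0 = linear₂ b a₁ a₁x₂≈cy₃ bx₂+a₀y₁+by₂≈0
        (solve 7 (λ b cy a₁ a₀ x₂ y₁ y₂ → b :* cy :+ a₁ :* (a₀ :* y₁) :+ a₁ :* (b :* y₂) :+ con false
          := b :* (a₁ :* x₂ :+ cy) :+ a₁ :* (b :* x₂ :+ a₀ :* y₁ :+ b :* y₂ :+ con false))
          refl b (c′ * y₃) a₁ a₀ x₂ y₁ y₂)
        where
        a₁x₂≈cy₃ : a₁ * x₂ ≈ c′ * y₃
        a₁x₂≈cy₃ = begin
          a₁ * x₂       ≈⟨ σ-* a₀ x₁ ⟨
          σ (a₀ * x₁)   ≈⟨ σ-cong a₀x₁≈by₂ ⟩
          σ (b * y₂)    ≈⟨ σ-* b y₂ ⟩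
          σ b * y₃      ≈⟨ *-congʳ σb≈c ⟩
          c′ * y₃       ∎

      -- After multiplication by `a₀ * y₁` and `a₁ * y₂`, both occurrences of u clear their
      -- denominators and what remains is `y₂` times the equation free of x.
      rel : u * σ u + u + 1# ≈ 0#
      rel = xy≈0⇒y≈0 (*-≉0 a₀y₁≉0 (*-≉0 (σ-≉0 a₀≉0) (σ-≉0 (σ-≉0 y≉0))))
        (linear₃ (a₁ * y₂ * σ u + a₁ * y₂) (b * y₂) y₂ a₀y₁u≈by₂ a₁y₂σu≈cy₃ bcy₃+a₀a₁y₁+a₁by₂≈0
          (solve 8 (λ a₀ a₁ y₁ y₂ u u₁ b cy →
            (a₀ :* y₁) :* (a₁ :* y₂) :* (u :* u₁ :+ u :+ con true) :+ con false
            := (a₁ :* y₂ :* u₁ :+ a₁ :* y₂) :* (a₀ :* y₁ :* u :+ b :* y₂) :+ (b :* y₂) :* (a₁ :* y₂ :* u₁ :+ cy)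
               :+ y₂ :* (b :* cy :+ a₁ :* (a₀ :* y₁) :+ a₁ :* (b :* y₂) :+ con false))
            refl a₀ a₁ y₁ y₂ u (σ u) b (c′ * y₃)))

    open Moebius u rel public

    private
      h₁ : a₁ * y₂ * u ≈ c′ * y₃
      h₁ = trans (*-congˡ (sym σu≈u)) a₁y₂σu≈cy₃

      h₂ : a₂ * y₃ * u ≈ b * y
      h₂ = trans (*-congˡ (sym σu≈u)) (trans (σ-eq h₁) (*-cong σc≈b (σ⁴ y)))

      h₃ : a₃ * y * u ≈ c′ * y₁
      h₃ = trans (*-cong (*-congˡ (sym (σ⁴ y))) (sym σu≈u))
        (trans (σ-eq (trans h₂ (*-congˡ (sym (σ⁴ y))))) (trans (*-cong σb≈c (σ-cong (σ⁴ y))) refl))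

      -- The norm of `a₀` to the fixed field of σ², and its conjugate.
      n m : Carrier
      n = a₀ * a₂
      m = a₁ * a₃

      -- The product of the four conjugate equations, in which y, `y₁`, `y₂`, `y₃` occur once on
      -- each side; u⁴ = u because u³ = 1.
      nmu≈P² : n * m * u ≈ P * P
      nmu≈P² = *-cancelˡ (*-≉0 (*-≉0 y≉0 (σ-≉0 y≉0)) (*-≉0 (σ-≉0 (σ-≉0 y≉0)) (σ-≉0 (σ-≉0 (σ-≉0 y≉0))))) (begin
        y * y₁ * (y₂ * y₃) * (n * m * u)
          ≈⟨ *-congˡ (*-congˡ u≈u⁴) ⟩
        y * y₁ * (y₂ * y₃) * (n * m * (u * u * (u * u)))
          ≈⟨ solve 9 (λ y y₁ y₂ y₃ a₀ a₁ a₂ a₃ u →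
               y :* y₁ :* (y₂ :* y₃) :* (a₀ :* a₂ :* (a₁ :* a₃) :* (u :* u :* (u :* u)))
               := (a₀ :* y₁ :* u) :* (a₁ :* y₂ :* u) :* ((a₂ :* y₃ :* u) :* (a₃ :* y :* u)))
             refl y y₁ y₂ y₃ a₀ a₁ a₂ a₃ u ⟩
        (a₀ * y₁ * u) * (a₁ * y₂ * u) * ((a₂ * y₃ * u) * (a₃ * y * u))
          ≈⟨ *-cong (*-cong a₀y₁u≈by₂ h₁) (*-cong h₂ h₃) ⟩
        (b * y₂) * (c′ * y₃) * ((b * y) * (c′ * y₁))
          ≈⟨ solve 6 (λ y y₁ y₂ y₃ b c → (b :* y₂) :* (c :* y₃) :* ((b :* y) :* (c :* y₁))
               := y :* y₁ :* (y₂ :* y₃) :* ((b :* c) :* (b :* c))) refl y y₁ y₂ y₃ b c′ ⟩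
        y * y₁ * (y₂ * y₃) * (P * P) ∎)
        where
        u≈u⁴ : u ≈ u * u * (u * u)
        u≈u⁴ = linear₁ (u * u + u) u²+u≈1 (solve 1 (λ u → u :+ u :* u :* (u :* u)
          := (u :* u :+ u) :* (u :* u :+ u :+ con true)) refl u)

      n+m≈P : n + m ≈ P
      n+m≈P = linear₁ a₁ a₃≈ (solve 4 (λ a₀ a₁ a₂ a₃ → a₀ :* a₂ :+ a₁ :* a₃ :+ (a₀ :+ a₁) :* (a₁ :+ a₂)
        := a₁ :* (a₃ :+ (a₀ :+ a₁ :+ a₂))) refl a₀ a₁ a₂ a₃)

      P≉0 : ¬ (P ≈ 0#)
      P≉0 = *-≉0 b≉0 c≉0

      σP≈P : σ P ≈ P
      σP≈P = trans (σ-* b c′) (trans (*-cong σb≈c σc≈b) (*-comm c′ b))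

    -- v and σ v are `n` and `m` divided by `P`. Their sum is 1 and their product is 1/u = u², so
    -- both are roots of X² + X + u².
    v : Carrier
    v = 1/ P P≉0 * n

    private
      Pv≈n : P * v ≈ n
      Pv≈n = trans (sym (*-assoc _ _ _)) (trans (*-congʳ (1/-inverseʳ P P≉0)) (*-identityˡ n))

      Pσv≈m : P * σ v ≈ m
      Pσv≈m = begin
        P * σ v      ≈⟨ *-congʳ σP≈P ⟨
        σ P * σ v    ≈⟨ σ-* P v ⟨
        σ (P * v)    ≈⟨ σ-cong Pv≈n ⟩
        σ n          ≈⟨ σ-* a₀ a₂ ⟩
        m            ∎

    σv≈v+1 : σ v ≈ v + 1#
    σv≈v+1 = *-cancelˡ P≉0 (linear₃ 1# 1# 1# Pσv≈m Pv≈n n+m≈P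
      (solve 5 (λ P v v₁ n m → P :* v₁ :+ P :* (v :+ con true)
        := con true :* (P :* v₁ :+ m) :+ con true :* (P :* v :+ n) :+ con true :* (n :+ m :+ P))
        refl P v (σ v) n m))

    v²+v≈u² : v * v + v ≈ u * u
    v²+v≈u² = linear₂ (u * u) (v * v + v + (v * v + v) * u) vσvu≈1 u²+u≈1 (solve 2 (λ u v →
      v :* v :+ v :+ u :* u := (u :* u) :* ((v :* v :+ v) :* u :+ con true)
        :+ (v :* v :+ v :+ (v :* v :+ v) :* u) :* (u :* u :+ u :+ con true)) refl u v)
      where
      vσvu≈1 : (v * v + v) * u ≈ 1#
      vσvu≈1 = *-cancelˡ (*-≉0 P≉0 P≉0) (begin
        P * P * ((v * v + v) * u)       ≈⟨ solve 3 (λ P v u → P :* P :* ((v :* v :+ v) :* u)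
                                             := (P :* v) :* (P :* (v :+ con true)) :* u) refl P v u ⟩
        (P * v) * (P * (v + 1#)) * u    ≈⟨ *-congʳ (*-cong Pv≈n (trans (*-congˡ (sym σv≈v+1)) Pσv≈m)) ⟩
        n * m * u                       ≈⟨ nmu≈P² ⟩
        P * P                           ≈⟨ *-identityʳ _ ⟨
        P * P * 1#                      ∎)

-- Computable models of F₄, F₁₆ and F₂₅₆

module RawFrobenius (A : RawSemiring 0ℓ 0ℓ) where
  open RawSemiring A

  frobᴿ : ℕ → Carrier → Carrier
  frobᴿ zero    x = x
  frobᴿ (suc k) x = frobᴿ k (x * x)

  Trᴿ : ℕ → Carrier → Carrier
  Trᴿ zero    x = 0#
  Trᴿ (suc k) x = x + Trᴿ k (x * x)

𝔹₂ : RawSemiring 0ℓ 0ℓ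
𝔹₂ = record { Carrier = Bool ; _≈_ = _≡_ ; _+_ = _xor_ ; _*_ = _∧_ ; 0# = false ; 1# = true }

-- A[X]/(X² + X + c), the pair (p , q) standing for p + q X.
AS-extension : (A : RawSemiring 0ℓ 0ℓ) → RawSemiring.Carrier A → RawSemiring 0ℓ 0ℓ
AS-extension A c = record
  { Carrier = A.Carrier × A.Carrier
  ; _≈_ = _≡_
  ; _+_ = λ (p , q) (r , s) → (p A.+ r) , (q A.+ s)
  ; _*_ = λ (p , q) (r , s) → ((p A.* r) A.+ ((q A.* s) A.* c)) , (((p A.* s) A.+ (q A.* r)) A.+ (q A.* s))
  ; 0# = A.0# , A.0#
  ; 1# = A.1# , A.0#
  }
  where module A = RawSemiring A

-- F₄ = F₂(ω) with ω² + ω = 1, F₁₆ = F₄(v) with v² + v = ω², F₂₅₆ = F₁₆(a) with a² + a = ω² v.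
𝔽₄ 𝔽₁₆ 𝔽₂₅₆ : RawSemiring 0ℓ 0ℓ
𝔽₄   = AS-extension 𝔹₂ true
𝔽₁₆  = AS-extension 𝔽₄ (true , true)
𝔽₂₅₆ = AS-extension 𝔽₁₆ ((false , false) , (true , true))

module 𝔽₂₅₆-Frobenius where
  open RawSemiring 𝔽₂₅₆
  open RawFrobenius 𝔽₂₅₆

  -- The equations are the last two coordinates of collinearity. The inverses certify that x and σ l
  -- + l stay nonzero in K: a homomorphism sends units to units.
  record Witness (r : ℕ) : Set where
    field
      l x y x⁻¹ a⁻¹ : Carrier
      eq₁ : l * (frobᴿ r x + frobᴿ r (frobᴿ r y)) ≡ frobᴿ r (l * x) + frobᴿ r (frobᴿ r (l * y))
      eq₂ : l * (frobᴿ r (frobᴿ r x) + frobᴿ r y + frobᴿ r (frobᴿ r y))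
            ≡ frobᴿ r (frobᴿ r (l * x)) + frobᴿ r (l * y) + frobᴿ r (frobᴿ r (l * y))
      x-unit : x * x⁻¹ ≡ 1#
      a-unit : (frobᴿ r l + l) * a⁻¹ ≡ 1#

  pattern 𝟎 = false , false
  pattern 𝟏 = true , false
  pattern ω = false , true
  pattern ω² = true , true

  witness₂ : Witness 2
  -- With a² + a = ω² v, here σ sends v to v + 1 and a to a + v + 1. The choice l = a + ω v gives σ
  -- l + l = v + ω² and σ² l + l = 1. For y = v this yields u = ω, and x = ω v solves (σ l + l) σ x
  -- = (σ² l + l) σ² y.
  witness₂ = record
    { l = (𝟎 , ω) , (𝟏 , 𝟎) ; x = (𝟎 , ω) , (𝟎 , 𝟎) ; y = (𝟎 , 𝟏) , (𝟎 , 𝟎)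
    ; x⁻¹ = (𝟏 , 𝟏) , (𝟎 , 𝟎) ; a⁻¹ = (𝟏 , ω²) , (𝟎 , 𝟎)
    ; eq₁ = ≡.refl ; eq₂ = ≡.refl ; x-unit = ≡.refl ; a-unit = ≡.refl }

  witness₆ : Witness 6
  -- Now σ sends a to a + v, while its action on F₁₆ is as before. With l = v + ω a one gets σ l + l
  -- = 1 + ω v and σ² l + l = ω; again y = v, u = ω and x = ω v.
  witness₆ = record
    { l = (𝟎 , 𝟏) , (ω , 𝟎) ; x = (𝟎 , ω) , (𝟎 , 𝟎) ; y = (𝟎 , 𝟏) , (𝟎 , 𝟎)
    ; x⁻¹ = (𝟏 , 𝟏) , (𝟎 , 𝟎) ; a⁻¹ = (ω² , ω) , (𝟎 , 𝟎)
    ; eq₁ = ≡.refl ; eq₂ = ≡.refl ; x-unit = ≡.refl ; a-unit = ≡.refl }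

-- Embedding the tower into K

module Embeddings {c ℓ} (K : Field c ℓ) (2≈0 : Characteristic2 K) where
  open Field K hiding (zero)
  open Char2 K 2≈0
  open SetoidReasoning setoid

  record Embedding (m : ℕ) (A : RawSemiring 0ℓ 0ℓ) : Set (c ⊔ ℓ) where
    private module A = RawSemiring A
    open RawFrobenius A
    field
      ⟦_⟧     : A.Carrier → Carrier
      ⟦⟧-+    : ∀ p q → ⟦ p A.+ q ⟧ ≈ ⟦ p ⟧ + ⟦ q ⟧
      ⟦⟧-*    : ∀ p q → ⟦ p A.* q ⟧ ≈ ⟦ p ⟧ * ⟦ q ⟧
      ⟦⟧-0    : ⟦ A.0# ⟧ ≈ 0#
      ⟦⟧-1    : ⟦ A.1# ⟧ ≈ 1#
      ⟦⟧-fixed : ∀ p → frob m ⟦ p ⟧ ≈ ⟦ p ⟧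

    ⟦⟧-frob : ∀ k p → ⟦ frobᴿ k p ⟧ ≈ frob k ⟦ p ⟧
    ⟦⟧-frob zero    p = refl
    ⟦⟧-frob (suc k) p = trans (⟦⟧-frob k _) (frob-cong k (⟦⟧-* p p))

    ⟦⟧-Tr : ∀ k p → ⟦ Trᴿ k p ⟧ ≈ Tr k ⟦ p ⟧
    ⟦⟧-Tr zero    p = ⟦⟧-0
    ⟦⟧-Tr (suc k) p = trans (⟦⟧-+ _ _) (+-congˡ (trans (⟦⟧-Tr k _) (Tr-cong k (⟦⟧-* p p))))

    σ-⟦⟧ : ∀ {h} r j → h ≡ r ℕ.+ j ℕ.* m → ∀ p → frob h ⟦ p ⟧ ≈ ⟦ frobᴿ r p ⟧
    σ-⟦⟧ r j h≡ p = trans (frob-mod m (⟦⟧-fixed p) r j h≡) (sym (⟦⟧-frob r p))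

  embed-𝔹₂ : ∀ m → Embedding m 𝔹₂
  embed-𝔹₂ m = record
    { ⟦_⟧ = ⟦_⟧₂ ; ⟦⟧-+ = ⟦⟧₂-+ ; ⟦⟧-* = ⟦⟧₂-* ; ⟦⟧-0 = refl ; ⟦⟧-1 = refl
    ; ⟦⟧-fixed = λ { false → frob-0 m ; true → frob-1 m } }

  module _ {n θ} (frob-n : frob n θ ≈ θ) (Tr-θ : Tr n θ ≈ 1#) {m j} (n≡j*m : n ≡ j ℕ.* m) where

    -- The vanishing trace of c serves twice: repeated over n = j m it makes X² + X + c solvable in
    -- K, and over length m it keeps the root fixed by `frob m`.
    embed-extension : ∀ {A} (c : RawSemiring.Carrier A) → RawFrobenius.Trᴿ A m c ≡ RawSemiring.0# A →
                      Embedding m A → Embedding m (AS-extension A c)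
    embed-extension {A} c Tr-c E = record
      { ⟦_⟧ = λ (p , q) → ⟦ p ⟧ + ⟦ q ⟧ * a
      ; ⟦⟧-+ = λ (p , q) (r , s) → trans (+-cong (⟦⟧-+ p r) (*-congʳ (⟦⟧-+ q s)))
          (solve 5 (λ p q r s a → p :+ r :+ (q :+ s) :* a := p :+ q :* a :+ (r :+ s :* a)) refl _ _ _ _ a)
      ; ⟦⟧-* = λ (p , q) (r , s) → trans
          (+-cong
            (trans (⟦⟧-+ _ _) (+-cong (⟦⟧-* p r) (trans (⟦⟧-* _ c) (*-congʳ (⟦⟧-* q s)))))
            (*-congʳ (trans (⟦⟧-+ _ _) (+-cong (trans (⟦⟧-+ _ _) (+-cong (⟦⟧-* p s) (⟦⟧-* q r))) (⟦⟧-* q s)))))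
          (linear₁ (⟦ q ⟧ * ⟦ s ⟧) a²+a≈c (solve 6 (λ p q r s a c →
            p :* r :+ q :* s :* c :+ (p :* s :+ q :* r :+ q :* s) :* a :+ (p :+ q :* a) :* (r :+ s :* a)
            := q :* s :* (a :* a :+ a :+ c)) refl ⟦ p ⟧ ⟦ q ⟧ ⟦ r ⟧ ⟦ s ⟧ a ⟦ c ⟧))
      ; ⟦⟧-0 = trans (+-cong ⟦⟧-0 (trans (*-congʳ ⟦⟧-0) (zeroˡ a))) (+-identityʳ 0#)
      ; ⟦⟧-1 = trans (+-cong ⟦⟧-1 (trans (*-congʳ ⟦⟧-0) (zeroˡ a))) (+-identityʳ 1#)
      ; ⟦⟧-fixed = λ (p , q) → trans (frob-+ m _ _) (+-cong (⟦⟧-fixed p)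
          (trans (frob-* m _ _) (*-cong (⟦⟧-fixed q) frob-a)))
      }
      where
      open Embedding E

      Tr-c≈0 : Tr m ⟦ c ⟧ ≈ 0#
      Tr-c≈0 = trans (sym (⟦⟧-Tr m c)) (trans (reflexive (≡.cong ⟦_⟧ Tr-c)) ⟦⟧-0)

      root : Σ Carrier λ a → a * a + a ≈ ⟦ c ⟧
      root = artin-schreier n frob-n Tr-θ ⟦ c ⟧
        (≡.subst (λ k → Tr k ⟦ c ⟧ ≈ 0#) (≡.sym n≡j*m) (Tr-period m (⟦⟧-fixed c) Tr-c≈0 j))

      a : Carrier
      a = proj₁ root

      a²+a≈c : a * a + a ≈ ⟦ c ⟧
      a²+a≈c = proj₂ root

      frob-a : frob m a ≈ a
      frob-a = trans (frob-root a²+a≈c m) (trans (+-congˡ Tr-c≈0) (+-identityʳ a))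

  embed-𝔽₂₅₆ : ∀ {n θ j} → frob n θ ≈ θ → Tr n θ ≈ 1# → n ≡ j ℕ.* 8 → Embedding 8 𝔽₂₅₆
  -- Each adjoined constant lies in F₂, F₄ or F₁₆, so its trace of length 8 is an even number of
  -- copies of a shorter trace; hence all three conditions hold by computation.
  embed-𝔽₂₅₆ {j = j} frob-n Tr-θ n≡j*8 = extend _ ≡.refl (extend _ ≡.refl (extend true ≡.refl (embed-𝔹₂ 8)))
    where
    extend : ∀ {A} (c : RawSemiring.Carrier A) → RawFrobenius.Trᴿ A 8 c ≡ RawSemiring.0# A →
             Embedding 8 A → Embedding 8 (AS-extension A c)
    extend = embed-extension frob-n Tr-θ {j = j} n≡j*8

-- A basis 1, β, α, βα adapted to the tower Fix σ ⊂ Fix σ² ⊂ K.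
module TraceBasis {c ℓ} (K : Field c ℓ) (2≈0 : Characteristic2 K)
                  (A : Automorphism K) where
  open Field K hiding (zero)
  open FieldProperties K
  open Char2 K 2≈0
  open Automorphism A
  open Order4 K 2≈0 A
  open Over K using (sumF)
  open SetoidReasoning setoid

  trσ : Carrier → Carrier
  trσ x = x + σ x + σ (σ x) + σ (σ (σ x))

  -- The trace is fixed by σ and hence so is its inverse, so dividing θ by its trace divides the
  -- trace by itself.
  trace-one : ∀ {θ} → ¬ (trσ θ ≈ 0#) → Σ Carrier λ α → trσ α ≈ 1#
  trace-one {θ} δ≉0 = θ * δ⁻¹ , (begin
    trσ (θ * δ⁻¹)
      ≈⟨ +-cong (+-cong (+-congˡ (s θ)) (trans (σ-cong (s θ)) (s _))) (trans (σ-cong (trans (σ-cong (s θ)) (s _))) (s _)) ⟩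
    θ * δ⁻¹ + σ θ * δ⁻¹ + σ (σ θ) * δ⁻¹ + σ (σ (σ θ)) * δ⁻¹
      ≈⟨ solve 5 (λ a b c d e → a :* e :+ b :* e :+ c :* e :+ d :* e := (a :+ b :+ c :+ d) :* e) refl _ _ _ _ δ⁻¹ ⟩
    trσ θ * δ⁻¹
      ≈⟨ 1/-inverseʳ _ δ≉0 ⟩
    1# ∎)
    where
    δ δ⁻¹ : Carrier
    δ = trσ θ
    δ⁻¹ = 1/ δ δ≉0

    σδ : σ δ ≈ δ
    σδ = begin
      σ δ        ≈⟨ trans (σ-+ _ _) (+-congʳ (trans (σ-+ _ _) (+-congʳ (σ-+ _ _)))) ⟩
      σ θ + σ (σ θ) + σ (σ (σ θ)) + σ (σ (σ (σ θ)))  ≈⟨ +-congˡ (σ⁴ θ) ⟩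
      σ θ + σ (σ θ) + σ (σ (σ θ)) + θ  ≈⟨ solve 4 (λ a b c d → b :+ c :+ d :+ a := a :+ b :+ c :+ d) refl _ _ _ _ ⟩
      δ          ∎

    σδ⁻¹ : σ δ⁻¹ ≈ δ⁻¹
    σδ⁻¹ = *-cancelˡ δ≉0 (begin
      δ * σ δ⁻¹     ≈⟨ *-congʳ σδ ⟨
      σ δ * σ δ⁻¹   ≈⟨ σ-* _ _ ⟨
      σ (δ * δ⁻¹)   ≈⟨ σ-cong (1/-inverseʳ _ δ≉0) ⟩
      σ 1#          ≈⟨ σ-1 ⟩
      1#            ≈⟨ 1/-inverseʳ _ δ≉0 ⟨
      δ * δ⁻¹       ∎)

    s : ∀ x → σ (x * δ⁻¹) ≈ σ x * δ⁻¹
    s x = trans (σ-* _ _) (*-congˡ σδ⁻¹)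

  module _ (α : Carrier) (trα : trσ α ≈ 1#) where

    β : Carrier
    β = α + σ (σ α)

    e : Fin 4 → Carrier
    e = 1# ∷ β ∷ α ∷ β * α ∷ []

    private
      combination : ∀ (d : Fin 4 → Carrier) → sumF (λ j → d j * e j)
                        ≈ (d zero + d (suc zero) * β) + (d (suc (suc zero)) + d (suc (suc (suc zero))) * β) * α
      combination d = solve 6 (λ p q r s α β →
        p :* con true :+ (q :* β :+ (r :* α :+ (s :* (β :* α) :+ con false))) := (p :+ q :* β) :+ (r :+ s :* β) :* α)
        refl _ _ _ _ α β

      -- β + σ β is the full trace of α, which is 1. Thus β generates the fixed field of σ² over
      -- that of σ.
      σβ : σ β ≈ β + 1#
      σβ = trans (σ-+ _ _) (linear₁ 1# trα (solve 4 (λ a b c d →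
        b :+ d :+ (a :+ c :+ con true) := con true :* (a :+ b :+ c :+ d :+ con true)) refl α (σ α) (σ (σ α)) (σ (σ (σ α)))))

      σ²β : σ (σ β) ≈ β
      σ²β = trans (σ-cong σβ) (trans (σ-+ _ _) (trans (+-cong σβ σ-1)
        (solve 1 (λ b → b :+ con true :+ con true := b) refl β)))

      β≉0 : ¬ (β ≈ 0#)
      β≉0 β≈0 = 1≉0 (begin
        1#         ≈⟨ solve 1 (λ b → con true := b :+ con true :+ b) refl β ⟩
        β + 1# + β ≈⟨ +-cong (trans (sym σβ) (σ-≈0 β≈0)) β≈0 ⟩
        0# + 0#    ≈⟨ +-identityʳ 0# ⟩
        0#         ∎)

      -- Adding the σ-conjugate to p + q β leaves q, which dictates the choice of q.
      split-β : ∀ z → σ (σ z) ≈ z → Σ Carrier λ p → Σ Carrier λ q → σ p ≈ p × σ q ≈ q × z ≈ p + q * β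
      split-β z σ²z = z + q * β , q , σp , σq , solve 2 (λ z t → z := z :+ t :+ t) refl z (q * β)
        where
        q : Carrier
        q = z + σ z
        σq : σ q ≈ q
        σq = trans (σ-+ _ _) (trans (+-congˡ σ²z) (+-comm _ _))
        σp : σ (z + q * β) ≈ z + q * β
        σp = trans (σ-+ _ _) (trans (+-congˡ (trans (σ-* _ _) (*-cong σq σβ)))
          (solve 3 (λ z w b → w :+ (z :+ w) :* (b :+ con true) := z :+ (z :+ w) :* b) refl z (σ z) β))

      -- Adding the σ²-conjugate to p + q α leaves q β, which dictates the choice of q.
      split-α : ∀ x → Σ Carrier λ p → Σ Carrier λ q → σ (σ p) ≈ p × σ (σ q) ≈ q × x ≈ p + q * α
      split-α x = x + q * α , q , σ²p , σ²q , solve 2 (λ z t → z := z :+ t :+ t) refl x (q * α)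
        where
        x₂ q : Carrier
        x₂ = σ (σ x)
        q = 1/ β β≉0 * (x + x₂)
        βq : β * q ≈ x + x₂
        βq = trans (sym (*-assoc _ _ _)) (trans (*-congʳ (1/-inverseʳ β β≉0)) (*-identityˡ _))
        σ²q : σ (σ q) ≈ q
        σ²q = *-cancelˡ β≉0 (begin
          β * σ (σ q)            ≈⟨ *-congʳ σ²β ⟨
          σ (σ β) * σ (σ q)      ≈⟨ trans (σ-cong (σ-* _ _)) (σ-* _ _) ⟨
          σ (σ (β * q))          ≈⟨ σ-cong (σ-cong βq) ⟩
          σ (σ (x + x₂))         ≈⟨ trans (σ-cong (σ-+ _ _)) (σ-+ _ _) ⟩
          x₂ + σ (σ x₂)          ≈⟨ +-congˡ (σ⁴ x) ⟩
          x₂ + x                 ≈⟨ +-comm _ _ ⟩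
          x + x₂                 ≈⟨ βq ⟨
          β * q                  ∎)
        σ²p : σ (σ (x + q * α)) ≈ x + q * α
        σ²p = begin
          σ (σ (x + q * α))           ≈⟨ trans (σ-cong (σ-+ _ _)) (σ-+ _ _) ⟩
          x₂ + σ (σ (q * α))          ≈⟨ +-congˡ (trans (σ-cong (σ-* _ _)) (trans (σ-* _ _) (*-congʳ σ²q))) ⟩
          x₂ + q * σ (σ α)            ≈⟨ linear₁ 1# βq (solve 5 (λ x x₂ q a a₂ →
                                           x₂ :+ q :* a₂ :+ (x :+ q :* a) := con true :* ((a :+ a₂) :* q :+ (x :+ x₂)))
                                           refl x x₂ q α (σ (σ α))) ⟩
          x + q * α                   ∎

    basis-spans : ∀ x → Σ (Fin 4 → Carrier) λ d → (∀ j → σ (d j) ≈ d j) × x ≈ sumF (λ j → d j * e j)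
    basis-spans x =
      let p , q , σ²p , σ²q , x≈ = split-α x
          d₀ , d₁ , σd₀ , σd₁ , p≈ = split-β p σ²p
          d₂ , d₃ , σd₂ , σd₃ , q≈ = split-β q σ²q
      in d₀ ∷ d₁ ∷ d₂ ∷ d₃ ∷ [] ,
         (λ { zero → σd₀ ; (suc zero) → σd₁ ; (suc (suc zero)) → σd₂ ; (suc (suc (suc zero))) → σd₃ }) ,
         trans x≈ (trans (+-cong p≈ (*-congʳ q≈)) (sym (combination (d₀ ∷ d₁ ∷ d₂ ∷ d₃ ∷ []))))

    private
      σ-fix-combination : ∀ {p q w} → σ p ≈ p → σ q ≈ q → σ (p + q * w) ≈ p + q * σ w
      σ-fix-combination σp σq = trans (σ-+ _ _) (+-cong σp (trans (σ-* _ _) (*-congʳ σq)))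

      independent-β : ∀ {p q} → σ p ≈ p → σ q ≈ q → p + q * β ≈ 0# → p ≈ 0# × q ≈ 0#
      independent-β {p} {q} σp σq eq = trans (sym (trans (+-congˡ (trans (*-congʳ q≈0) (zeroˡ β))) (+-identityʳ p))) eq , q≈0
        where
        q≈0 : q ≈ 0#
        q≈0 = linear₂ 1# 1# eq (trans (+-congˡ (*-congˡ (sym σβ))) (trans (sym (σ-fix-combination σp σq)) (σ-≈0 eq)))
          (solve 3 (λ p q b → q :+ con false
            := con true :* (p :+ q :* b :+ con false) :+ con true :* (p :+ q :* (b :+ con true) :+ con false)) refl p q β)

      independent-α : ∀ {p q} → σ (σ p) ≈ p → σ (σ q) ≈ q → p + q * α ≈ 0# → p ≈ 0# × q ≈ 0#
      independent-α {p} {q} σ²p σ²q eq = trans (sym (trans (+-congˡ (trans (*-congʳ q≈0) (zeroˡ α))) (+-identityʳ p))) eq , q≈0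
        where
        σ²eq : p + q * σ (σ α) ≈ 0#
        σ²eq = begin
          p + q * σ (σ α)              ≈⟨ +-cong σ²p (*-congʳ σ²q) ⟨
          σ (σ p) + σ (σ q) * σ (σ α)  ≈⟨ +-congˡ (trans (σ-cong (σ-* _ _)) (σ-* _ _)) ⟨
          σ (σ p) + σ (σ (q * α))      ≈⟨ trans (σ-cong (σ-+ _ _)) (σ-+ _ _) ⟨
          σ (σ (p + q * α))            ≈⟨ σ-≈0 (σ-≈0 eq) ⟩
          0#                           ∎
        q≈0 : q ≈ 0#
        q≈0 = xy≈0⇒y≈0 β≉0 (linear₂ 1# 1# eq σ²eq (solve 4 (λ p q a a₂ → (a :+ a₂) :* q :+ con false
            := con true :* (p :+ q :* a :+ con false) :+ con true :* (p :+ q :* a₂ :+ con false)) refl p q α (σ (σ α))))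

      fixed² : ∀ {p q} → σ p ≈ p → σ q ≈ q → σ (σ (p + q * β)) ≈ p + q * β
      fixed² σp σq = trans (σ-cong (σ-fix-combination σp σq)) (trans (σ-fix-combination σp σq) (+-congˡ (*-congˡ σ²β)))

    basis-independent : ∀ d → (∀ j → σ (d j) ≈ d j) → sumF (λ j → d j * e j) ≈ 0# → ∀ j → d j ≈ 0#
    basis-independent d σd eq = λ
      { zero → proj₁ d₀₁ ; (suc zero) → proj₂ d₀₁
      ; (suc (suc zero)) → proj₁ d₂₃ ; (suc (suc (suc zero))) → proj₂ d₂₃ }
      where
      pq : d zero + d (suc zero) * β ≈ 0# × d (suc (suc zero)) + d (suc (suc (suc zero))) * β ≈ 0#
      pq = independent-α (fixed² (σd zero) (σd (suc zero))) (fixed² (σd (suc (suc zero))) (σd (suc (suc (suc zero))))) (trans (sym (combination d)) eq)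
      d₀₁ : d zero ≈ 0# × d (suc zero) ≈ 0#
      d₀₁ = independent-β (σd zero) (σd (suc zero)) (proj₁ pq)
      d₂₃ : d (suc (suc zero)) ≈ 0# × d (suc (suc (suc zero))) ≈ 0#
      d₂₃ = independent-β (σd (suc (suc zero))) (σd (suc (suc (suc zero)))) (proj₂ pq)

-- Residues of h and finite sums

Fin-splitting : ∀ {p} m {n} (P : Fin (m ℕ.+ n) → Set p) →
                (∀ i → P (i ↑ˡ n)) → (∀ j → P (m ↑ʳ j)) → ∀ k → P k
Fin-splitting zero    P l r k       = r k
Fin-splitting (suc m) P l r zero    = l zero
Fin-splitting (suc m) P l r (suc k) = Fin-splitting m (λ k → P (suc k)) (λ i → l (suc i)) r k

%4-from-%8 : ∀ {h} r i → h ≡ r ℕ.+ i ℕ.* 8 → h % 4 ≡ r % 4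
%4-from-%8 r i ≡.refl = ≡.trans (≡.cong (λ k → (r ℕ.+ k) % 4) (≡.sym (ℕ.*-assoc i 2 4))) (ℕ.[m+kn]%n≡m%n r (i ℕ.* 2) 4)

2mod4⇒2or6mod8 : ∀ h → h % 4 ≡ 2 → h % 8 ≡ 2 ⊎ h % 8 ≡ 6
2mod4⇒2or6mod8 h h%4≡2 with h % 8 | ≡.trans (≡.sym (%4-from-%8 (h % 8) (h ℕ./ 8) (ℕ.m≡m%n+[m/n]*n h 8))) h%4≡2 | ℕ.m%n<n h 8
... | 2 | _ | _ = inj₁ ≡.refl
... | 6 | _ | _ = inj₂ ≡.refl
... | suc (suc (suc (suc (suc (suc (suc (suc _))))))) | _
    | ℕ.s≤s (ℕ.s≤s (ℕ.s≤s (ℕ.s≤s (ℕ.s≤s (ℕ.s≤s (ℕ.s≤s (ℕ.s≤s ())))))))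

-- K has degree 4h over F₂, so this divisibility is what makes room for F₂₅₆.
2mod4⇒8∣4h : ∀ h → h % 4 ≡ 2 → 4 ℕ.* h ≡ (1 ℕ.+ (h ℕ./ 4) ℕ.* 2) ℕ.* 8
2mod4⇒8∣4h h h%4≡2 = ≡.trans
  (≡.cong (4 ℕ.*_) (≡.trans (ℕ.m≡m%n+[m/n]*n h 4) (≡.cong (ℕ._+ (h ℕ./ 4) ℕ.* 4) h%4≡2)))
  (solve 1 (λ j → con 4 :* (con 2 :+ j :* con 4) := (con 1 :+ j :* con 2) :* con 8) ≡.refl (h ℕ./ 4))
  where open +-*-Solver using (solve; _:+_; _:*_; _:=_; con)

module Sums {c ℓ} (K : Field c ℓ) where
  open Field K using (Carrier; _≈_; _+_; 0#; refl; sym; trans; +-cong; +-congˡ; +-assoc; +-identityˡ)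
  open Over K using (sumF)

  sumF-cong : ∀ {n} {f g : Fin n → Carrier} → (∀ j → f j ≈ g j) → sumF f ≈ sumF g
  sumF-cong {zero}  f≈g = refl
  sumF-cong {suc n} f≈g = +-cong (f≈g zero) (sumF-cong (λ j → f≈g (suc j)))

  sumF-≈0 : ∀ {n} {f : Fin n → Carrier} → (∀ j → f j ≈ 0#) → sumF f ≈ 0#
  sumF-≈0 {zero}  f≈0 = refl
  sumF-≈0 {suc n} f≈0 = trans (+-cong (f≈0 zero) (sumF-≈0 (λ j → f≈0 (suc j)))) (+-identityˡ 0#)

  sumF-splitting : ∀ m {n} (f : Fin (m ℕ.+ n) → Carrier) → sumF f ≈ sumF (λ i → f (i ↑ˡ n)) + sumF (λ j → f (m ↑ʳ j))
  sumF-splitting zero    f = sym (+-identityˡ _)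
  sumF-splitting (suc m) f = trans (+-congˡ (sumF-splitting m (λ i → f (suc i)))) (sym (+-assoc _ _ _))

-- The set U for x ↦ x^q, and its dimension

module Frobenius4 {c ℓ} (K : Field c ℓ) (2≈0 : Characteristic2 K)
  (_≟_ : ∀ x y → Dec (Field._≈_ K x y)) (h : ℕ)
  (frob-4h : ∀ x → Field._≈_ K (Char2.frob K 2≈0 (4 ℕ.* h) x) x) where

  open Field K hiding (zero)
  open FieldProperties K
  open Char2 K 2≈0
  open Over K
  open Subfield (2 ℕ.^ h)
  open Thm K (2 ℕ.^ h)
  open Sums K
  open SetoidReasoning setoid

  private
    q = 2 ℕ.^ h

    σ : Carrier → Carrier
    σ = frob h

    frob-4h≡ : ∀ x → frob (4 ℕ.* h) x ≡ σ (σ (σ (σ x)))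
    frob-4h≡ x = ≡.trans (frob-∘ h (3 ℕ.* h) x) (≡.trans (frob-∘ h (2 ℕ.* h) (σ x))
      (≡.trans (frob-∘ h (1 ℕ.* h) (σ (σ x))) (frob-∘ h 0 (σ (σ (σ x))))))

  automorphism : Automorphism K
  automorphism = record
    { σ = σ ; σ-cong = frob-cong h ; σ-+ = frob-+ h ; σ-* = frob-* h ; σ-1 = frob-1 h
    ; σ⁴ = λ x → trans (reflexive (≡.sym (frob-4h≡ x))) (frob-4h x) }

  private
    module A = Automorphism automorphism
  open Order4 K 2≈0 automorphism
  open TraceBasis K 2≈0 automorphism

  pow-q : ∀ x → pow x q ≈ σ x
  pow-q = pow-2^ h

  pow-q² : ∀ x → pow x (q ℕ.* q) ≈ σ (σ x)
  pow-q² x = trans (pow-* x q q) (trans (pow-q (pow x q)) (A.σ-cong (pow-q x)))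

  InFq⇒fixed : ∀ {a} → InFq a → σ a ≈ a
  InFq⇒fixed {a} a∈Fq = trans (sym (pow-q a)) a∈Fq

  fixed⇒InFq : ∀ {a} → σ a ≈ a → InFq a
  fixed⇒InFq {a} σa = trans (pow-q a) σa

  vecσ : Carrier → Carrier → Vect 4
  vecσ x y = x ∷ y ∷ σ x + σ (σ y) ∷ σ (σ x) + σ y + σ (σ y) ∷ []

  vecU≈vecσ : ∀ x y → vecU x y ≈ᵥ vecσ x y
  vecU≈vecσ x y zero                   = refl
  vecU≈vecσ x y (suc zero)             = refl
  vecU≈vecσ x y (suc (suc zero))       = +-cong (pow-q x) (pow-q² y)
  vecU≈vecσ x y (suc (suc (suc zero))) = +-cong (+-cong (pow-q² x) (pow-q y)) (pow-q² y)

  vecσ-cong : ∀ {x x′ y y′} → x ≈ x′ → y ≈ y′ → vecσ x y ≈ᵥ vecσ x′ y′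
  vecσ-cong x≈ y≈ zero                   = x≈
  vecσ-cong x≈ y≈ (suc zero)             = y≈
  vecσ-cong x≈ y≈ (suc (suc zero))       = +-cong (A.σ-cong x≈) (A.σ-cong (A.σ-cong y≈))
  vecσ-cong x≈ y≈ (suc (suc (suc zero))) =
    +-cong (+-cong (A.σ-cong (A.σ-cong x≈)) (A.σ-cong y≈)) (A.σ-cong (A.σ-cong y≈))

  vecσ-0 : ∀ i → vecσ 0# 0# i ≈ 0#
  vecσ-0 zero                   = refl
  vecσ-0 (suc zero)             = refl
  vecσ-0 (suc (suc zero))       = trans (+-cong σ-0 (σ-≈0 σ-0)) (+-identityʳ 0#)
  vecσ-0 (suc (suc (suc zero))) =
    trans (+-cong (trans (+-cong (σ-≈0 σ-0) σ-0) (+-identityʳ 0#)) (σ-≈0 σ-0)) (+-identityʳ 0#)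

  σ²-+ : ∀ x y → σ (σ (x + y)) ≈ σ (σ x) + σ (σ y)
  σ²-+ x y = trans (A.σ-cong (A.σ-+ x y)) (A.σ-+ _ _)

  vecσ-+ : ∀ x y x′ y′ i → vecσ (x + x′) (y + y′) i ≈ vecσ x y i + vecσ x′ y′ i
  vecσ-+ x y x′ y′ zero             = refl
  vecσ-+ x y x′ y′ (suc zero)       = refl
  vecσ-+ x y x′ y′ (suc (suc zero)) = trans (+-cong (A.σ-+ x x′) (σ²-+ y y′))
    (solve 4 (λ a b c d → a :+ b :+ (c :+ d) := a :+ c :+ (b :+ d)) refl _ _ _ _)
  vecσ-+ x y x′ y′ (suc (suc (suc zero))) = trans (+-cong (+-cong (σ²-+ x x′) (A.σ-+ y y′)) (σ²-+ y y′))
    (solve 6 (λ a b c d e f → a :+ b :+ (c :+ d) :+ (e :+ f) := a :+ c :+ e :+ (b :+ d :+ f)) refl _ _ _ _ _ _)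

  vecσ-* : ∀ {a} → σ a ≈ a → ∀ x y i → vecσ (a * x) (a * y) i ≈ a * vecσ x y i
  vecσ-* {a} σa x y = λ
    { zero                   → refl
    ; (suc zero)             → refl
    ; (suc (suc zero))       → trans (+-cong (s x) (s² y)) (sym (distribˡ a _ _))
    ; (suc (suc (suc zero))) → trans (+-cong (+-cong (s² x) (s y)) (s² y))
        (solve 4 (λ a b c d → a :* b :+ a :* c :+ a :* d := a :* (b :+ c :+ d)) refl a _ _ _)
    }
    where
    s : ∀ x → σ (a * x) ≈ a * σ x
    s x = trans (A.σ-* a x) (*-congʳ σa)
    s² : ∀ x → σ (σ (a * x)) ≈ a * σ (σ x)
    s² x = trans (A.σ-cong (s x)) (s (σ x))

  lincomb-vecσ : ∀ {n} (a xs ys : Fin n → Carrier) → (∀ j → σ (a j) ≈ a j) →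
    lincomb a (λ j → vecσ (xs j) (ys j)) ≈ᵥ vecσ (sumF λ j → a j * xs j) (sumF λ j → a j * ys j)
  lincomb-vecσ {zero}  a xs ys σa i = sym (vecσ-0 i)
  lincomb-vecσ {suc n} a xs ys σa i = sym (trans (vecσ-+ _ _ _ _ i) (+-cong (vecσ-* (σa zero) (xs zero) (ys zero) i)
    (sym (lincomb-vecσ (λ j → a (suc j)) (λ j → xs (suc j)) (λ j → ys (suc j)) (λ j → σa (suc j)) i))))

  module DoubledBasis {m} (bK : Fin m → Carrier)
    (spans : ∀ x → Σ (Fin m → Carrier) λ d → (∀ j → σ (d j) ≈ d j) × x ≈ sumF (λ j → d j * bK j))
    (independent : ∀ (d : Fin m → Carrier) → (∀ j → σ (d j) ≈ d j) → sumF (λ j → d j * bK j) ≈ 0# → ∀ j → d j ≈ 0#) where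

    private
      0s : Fin m → Carrier
      0s _ = 0#

      xs ys : Fin (m ℕ.+ m) → Carrier
      xs = bK ++ 0s
      ys = 0s ++ bK

      bU : Fin (m ℕ.+ m) → Vect 4
      bU j = vecU (xs j) (ys j)

      sum-xs : ∀ (a : Fin (m ℕ.+ m) → Carrier) → sumF (λ j → a j * xs j) ≈ sumF (λ j → a (j ↑ˡ m) * bK j)
      sum-xs a = trans (sumF-splitting m (λ j → a j * xs j)) (trans
        (+-cong (sumF-cong (λ j → *-congˡ (reflexive (lookup-++ˡ bK 0s j))))
                (sumF-≈0 (λ j → trans (*-congˡ (reflexive (lookup-++ʳ bK 0s j))) (zeroʳ _))))
        (+-identityʳ _))

      sum-ys : ∀ (a : Fin (m ℕ.+ m) → Carrier) → sumF (λ j → a j * ys j) ≈ sumF (λ j → a (m ↑ʳ j) * bK j)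
      sum-ys a = trans (sumF-splitting m (λ j → a j * ys j)) (trans
        (+-cong (sumF-≈0 (λ j → trans (*-congˡ (reflexive (lookup-++ˡ 0s bK j))) (zeroʳ _)))
                (sumF-cong (λ j → *-congˡ (reflexive (lookup-++ʳ 0s bK j)))))
        (+-identityˡ _))

      lincomb-bU : ∀ (a : Fin (m ℕ.+ m) → Carrier) → (∀ j → InFq (a j)) →
                   lincomb a bU ≈ᵥ vecσ (sumF λ j → a (j ↑ˡ m) * bK j) (sumF λ j → a (m ↑ʳ j) * bK j)
      lincomb-bU a a∈Fq i = begin
        lincomb a bU i
          ≈⟨ sumF-cong (λ j → *-congˡ (vecU≈vecσ (xs j) (ys j) i)) ⟩
        lincomb a (λ j → vecσ (xs j) (ys j)) i
          ≈⟨ lincomb-vecσ a xs ys (λ j → InFq⇒fixed (a∈Fq j)) i ⟩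
        vecσ (sumF λ j → a j * xs j) (sumF λ j → a j * ys j) i
          ≈⟨ vecσ-cong (sum-xs a) (sum-ys a) i ⟩
        vecσ (sumF λ j → a (j ↑ˡ m) * bK j) (sumF λ j → a (m ↑ʳ j) * bK j) i ∎

    -- The map (x, y) ↦ `vecσ x y` is F_q-linear and its first two coordinates return x and y, so a
    -- basis of K used once in each argument gives a basis of U.
    U-dimension : IsSubspaceOfDim U (m ℕ.+ m)
    U-dimension = bU , U-independent , λ v → U⇒span v , span⇒U v
      where
      U-independent : LinIndepFq bU
      U-independent a a∈Fq eq = Fin-splitting m (λ j → a j ≈ 0#)
        (independent (λ j → a (j ↑ˡ m)) (λ j → InFq⇒fixed (a∈Fq (j ↑ˡ m)))
          (trans (sym (lincomb-bU a a∈Fq zero)) (eq zero)))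
        (independent (λ j → a (m ↑ʳ j)) (λ j → InFq⇒fixed (a∈Fq (m ↑ʳ j)))
          (trans (sym (lincomb-bU a a∈Fq (suc zero))) (eq (suc zero))))

      U⇒span : ∀ v → U v → InSpanFq bU v
      U⇒span v (x , y , v≈) = a , a∈Fq , λ i → begin
        v i              ≈⟨ v≈ i ⟩
        vecU x y i       ≈⟨ vecU≈vecσ x y i ⟩
        vecσ x y i       ≈⟨ vecσ-cong (trans x≈ (sumF-cong λ j → *-congʳ (reflexive (≡.sym (lookup-++ˡ dx dy j)))))
                                      (trans y≈ (sumF-cong λ j → *-congʳ (reflexive (≡.sym (lookup-++ʳ dx dy j))))) i ⟩
        vecσ (sumF λ j → a (j ↑ˡ m) * bK j) (sumF λ j → a (m ↑ʳ j) * bK j) i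
                         ≈⟨ lincomb-bU a a∈Fq i ⟨
        lincomb a bU i   ∎
        where
        dx dy : Fin m → Carrier
        dx = proj₁ (spans x)
        dy = proj₁ (spans y)
        x≈ : x ≈ sumF (λ j → dx j * bK j)
        x≈ = proj₂ (proj₂ (spans x))
        y≈ : y ≈ sumF (λ j → dy j * bK j)
        y≈ = proj₂ (proj₂ (spans y))
        a : Fin (m ℕ.+ m) → Carrier
        a = dx ++ dy
        a∈Fq : ∀ j → InFq (a j)
        a∈Fq = Fin-splitting m (λ j → InFq (a j))
          (λ j → ≡.subst InFq (≡.sym (lookup-++ˡ dx dy j)) (fixed⇒InFq (proj₁ (proj₂ (spans x)) j)))
          (λ j → ≡.subst InFq (≡.sym (lookup-++ʳ dx dy j)) (fixed⇒InFq (proj₁ (proj₂ (spans y)) j)))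

      span⇒U : ∀ v → InSpanFq bU v → U v
      span⇒U v (a , a∈Fq , v≈) = _ , _ , λ i →
        trans (v≈ i) (trans (lincomb-bU a a∈Fq i) (sym (vecU≈vecσ _ _ i)))

  module Basis (θ : Carrier) (Tr-θ : Tr (4 ℕ.* h) θ ≈ 1#) where

    -- Transitivity of the trace; it shows that an element of absolute trace 1 has nonzero relative
    -- trace.
    Tr-h-trσ : Tr (4 ℕ.* h) θ ≈ Tr h (trσ θ)
    Tr-h-trσ = begin
      Tr (4 ℕ.* h) θ
        ≈⟨ trans (Tr-∘ h (3 ℕ.* h) θ) (+-congˡ (trans (Tr-∘ h (2 ℕ.* h) (σ θ)) (+-congˡ
             (trans (Tr-∘ h (1 ℕ.* h) (σ (σ θ))) (+-congˡ (Tr-∘ h 0 (σ (σ (σ θ))))))))) ⟩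
      Tr h θ + (Tr h (σ θ) + (Tr h (σ (σ θ)) + (Tr h (σ (σ (σ θ))) + 0#)))
        ≈⟨ solve 4 (λ a b c d → a :+ (b :+ (c :+ (d :+ con false))) := a :+ b :+ c :+ d) refl _ _ _ _ ⟩
      Tr h θ + Tr h (σ θ) + Tr h (σ (σ θ)) + Tr h (σ (σ (σ θ)))
        ≈⟨ trans (Tr-+ h _ _) (+-congʳ (trans (Tr-+ h _ _) (+-congʳ (Tr-+ h _ _)))) ⟨
      Tr h (trσ θ) ∎

    α-trace : Σ Carrier λ α → trσ α ≈ 1#
    α-trace = trace-one λ tr≈0 → 1≉0 (begin
      1#              ≈⟨ Tr-θ ⟨
      Tr (4 ℕ.* h) θ  ≈⟨ Tr-h-trσ ⟩
      Tr h (trσ θ)    ≈⟨ Tr-cong h tr≈0 ⟩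
      Tr h 0#         ≈⟨ Tr-0 h ⟩
      0#              ∎)

    U-dimension-8 : IsSubspaceOfDim U 8
    U-dimension-8 = U-dimension
      where
      open DoubledBasis (e (proj₁ α-trace) (proj₂ α-trace))
        (basis-spans (proj₁ α-trace) (proj₂ α-trace)) (basis-independent (proj₁ α-trace) (proj₂ α-trace))

  -- Scatteredness according to h modulo 4

  module _ {u} (u²+u≈1 : u * u + u ≈ 1#) where

    frob-2-u : frob 2 u ≈ u
    frob-2-u = linear₁ (u * u + u) u²+u≈1
      (solve 1 (λ u → (u :* u) :* (u :* u) :+ u := (u :* u :+ u) :* (u :* u :+ u :+ con true)) refl u)

    -- u² lies in F₄, so its trace of length 4 is twice the one of length 2. Hence v lies in F₁₆.
    frob-4-v : ∀ {v} → v * v + v ≈ u * u → frob 4 v ≈ v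
    frob-4-v {v} v²+v≈u² = begin
      frob 4 v                                           ≈⟨ frob-root v²+v≈u² 4 ⟩
      v + Tr 4 (u * u)                                   ≈⟨ +-congˡ (Tr-∘ 2 2 (u * u)) ⟩
      v + (Tr 2 (u * u) + Tr 2 (frob 2 (u * u)))         ≈⟨ +-congˡ (+-congˡ (Tr-cong 2 frob-2-uu)) ⟩
      v + (Tr 2 (u * u) + Tr 2 (u * u))                  ≈⟨ +-congˡ (x+x≈0 (Tr 2 (u * u))) ⟩
      v + 0#                                             ≈⟨ +-identityʳ v ⟩
      v                                                  ∎
      where
      frob-2-uu : frob 2 (u * u) ≈ u * u
      frob-2-uu = trans (frob-* 2 u u) (*-cong frob-2-u frob-2-u)

    frob-odd-u : ∀ r j → h ≡ r ℕ.+ j ℕ.* 4 → frob r u ≈ u * u → ¬ (σ u ≈ u)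
    frob-odd-u r j h≡ frob-r-u σu≈u = 1≉0 (begin
      1#           ≈⟨ u²+u≈1 ⟨
      u * u + u    ≈⟨ +-congʳ (trans (sym (trans (frob-mod 4 (frob-fix-* 2 frob-2-u 2) r j h≡) frob-r-u)) σu≈u) ⟩
      u + u        ≈⟨ x+x≈0 u ⟩
      0#           ∎)

  -- For odd h, σ acts on F₄ as squaring and moves u; for h divisible by 4, it fixes all of F₁₆ and
  -- so cannot send v to v + 1.
  no-bad-pair : h % 4 ≢ 2 → ∀ {u v} → u * u + u ≈ 1# → σ u ≈ u → v * v + v ≈ u * u → ¬ (σ v ≈ v + 1#)
  no-bad-pair h%4≢2 {u} {v} u²+u≈1 σu≈u v²+v≈u² σv≈v+1
    with h % 4 | ℕ.m≡m%n+[m/n]*n h 4 | ℕ.m%n<n h 4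
  ... | 0 | h≡ | _ = 1≉0 (linear₂ 1# 1# (frob-mod 4 (frob-4-v u²+u≈1 v²+v≈u²) 0 (h ℕ./ 4) h≡) σv≈v+1
    (solve 2 (λ v w → con true :+ con false := con true :* (w :+ v) :+ con true :* (w :+ (v :+ con true))) refl v (σ v)))
  ... | 1 | h≡ | _ = frob-odd-u u²+u≈1 1 (h ℕ./ 4) h≡ refl σu≈u
  ... | 2 | h≡ | _ = h%4≢2 ≡.refl
  ... | 3 | h≡ | _ = frob-odd-u u²+u≈1 3 (h ℕ./ 4) h≡ (*-cong (frob-2-u u²+u≈1) (frob-2-u u²+u≈1)) σu≈u
  ... | suc (suc (suc (suc _))) | h≡ | ℕ.s≤s (ℕ.s≤s (ℕ.s≤s (ℕ.s≤s ())))

  scattered : h % 4 ≢ 2 → Scattered U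
  scattered h%4≢2 w w≉0 u₁ u₂ (x , y , u₁≈) (x′ , y′ , u₂≈) (m₁ , u₁≈m₁w) (m₂ , u₂≈m₂w) with m₁ ≟ 0#
  -- Here `u₁` is the zero vector, which is dependent by itself.
  ... | yes m₁≈0 = 1# , 0# , fixed⇒InFq (frob-1 h) , fixed⇒InFq (frob-0 h) , (λ (1≈0 , _) → 1≉0 1≈0) , λ i → begin
    1# * u₁ i + 0# * u₂ i    ≈⟨ +-cong (*-identityˡ _) (zeroˡ _) ⟩
    u₁ i + 0#                ≈⟨ +-identityʳ _ ⟩
    u₁ i                     ≈⟨ u₁≈m₁w i ⟩
    m₁ * w i                 ≈⟨ *-congʳ m₁≈0 ⟩
    0# * w i                 ≈⟨ zeroˡ _ ⟩
    0#                       ∎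
  ... | no m₁≉0 = dependent (σ l ≟ l)
    where
    l : Carrier
    l = m₂ * 1/ m₁ m₁≉0

    u₂≈lu₁ : ∀ i → u₂ i ≈ l * u₁ i
    u₂≈lu₁ i = begin
      u₂ i                          ≈⟨ u₂≈m₂w i ⟩
      m₂ * w i                      ≈⟨ *-congʳ (*-identityʳ m₂) ⟨
      m₂ * 1# * w i                 ≈⟨ *-congʳ (*-congˡ (1/-inverseʳ m₁ m₁≉0)) ⟨
      m₂ * (m₁ * 1/ m₁ m₁≉0) * w i  ≈⟨ solve 4 (λ a b c d → a :* (b :* c) :* d := a :* c :* (b :* d)) refl m₂ m₁ _ (w i) ⟩
      l * (m₁ * w i)                ≈⟨ *-congˡ (u₁≈m₁w i) ⟨
      l * u₁ i                      ∎

    u₁≈vecσ : ∀ i → u₁ i ≈ vecσ x y i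
    u₁≈vecσ i = trans (u₁≈ i) (vecU≈vecσ x y i)

    u₂≈vecσ : ∀ i → u₂ i ≈ vecσ x′ y′ i
    u₂≈vecσ i = trans (u₂≈ i) (vecU≈vecσ x′ y′ i)

    -- The first two coordinates of `u₂` force its parameters to be l x and l y; the last two then
    -- become the equations required by `Line`.
    collinear : ∀ i → l * vecσ x y i ≈ vecσ (l * x) (l * y) i
    collinear i = begin
      l * vecσ x y i          ≈⟨ *-congˡ (u₁≈vecσ i) ⟨
      l * u₁ i                ≈⟨ u₂≈lu₁ i ⟨
      u₂ i                    ≈⟨ u₂≈vecσ i ⟩
      vecσ x′ y′ i            ≈⟨ vecσ-cong (scaled zero) (scaled (suc zero)) i ⟩
      vecσ (l * x) (l * y) i  ∎
      where
      scaled : ∀ i → vecσ x′ y′ i ≈ l * vecσ x y i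
      scaled i = trans (sym (u₂≈vecσ i)) (trans (u₂≈lu₁ i) (*-congˡ (u₁≈vecσ i)))

    xy≉0 : ¬ (x ≈ 0# × y ≈ 0#)
    xy≉0 (x≈0 , y≈0) = w≉0 λ i → xy≈0⇒y≈0 m₁≉0
      (trans (sym (u₁≈m₁w i)) (trans (u₁≈vecσ i) (trans (vecσ-cong x≈0 y≈0 i) (vecσ-0 i))))

    dependent : Dec (σ l ≈ l) → Σ Carrier λ a₁ → Σ Carrier λ a₂ → InFq a₁ × InFq a₂ ×
                (¬ (a₁ ≈ 0# × a₂ ≈ 0#)) × ((a₁ · u₁) +ᵥ (a₂ · u₂)) ≈ᵥ 0ᵥ
    dependent (yes σl≈l) = l , 1# , fixed⇒InFq σl≈l , fixed⇒InFq (frob-1 h) , (λ (_ , 1≈0) → 1≉0 1≈0) , λ i →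
      trans (+-cong (sym (u₂≈lu₁ i)) (*-identityˡ _)) (x+x≈0 _)
    dependent (no σl≉l) = contradiction σv≈v+1 (no-bad-pair h%4≢2 u²+u≈1 σu≈u v²+v≈u²)
      where open Line l x y σl≉l xy≉0 (collinear (suc (suc zero))) (collinear (suc (suc (suc zero))))

  -- A relation over F_q between a vector and its l-fold gives a₁ = a₂ l at the nonzero coordinate
  -- x. Applying σ yields a₂ (σ l + l) = 0, so both coefficients vanish.
  not-scattered : ∀ {l x y} → ¬ (σ l ≈ l) → ¬ (x ≈ 0#) → (∀ i → l * vecσ x y i ≈ vecσ (l * x) (l * y) i) → ¬ Scattered U
  not-scattered {l} {x} {y} l∉F x≉0 collinear scat
    with a₁ , a₂ , a₁∈F , a₂∈F , a≉0 , eq ← scat (vecU x y) (λ w≈0 → x≉0 (w≈0 zero)) (vecU x y) (vecU (l * x) (l * y))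
           (x , y , λ _ → refl) (l * x , l * y , λ _ → refl)
           (1# , λ i → sym (*-identityˡ _))
           (l , λ i → trans (vecU≈vecσ _ _ i) (trans (sym (collinear i)) (*-congˡ (sym (vecU≈vecσ x y i)))))
    = a≉0 (trans a₁≈a₂l (trans (*-congʳ a₂≈0) (zeroˡ l)) , a₂≈0)
    where
    a₁≈a₂l : a₁ ≈ a₂ * l
    a₁≈a₂l = *-cancelˡ x≉0 (linear₁ 1# (eq zero) (solve 4 (λ a b l x →
      x :* a :+ x :* (b :* l) := con true :* (a :* x :+ b :* (l :* x) :+ con false)) refl a₁ a₂ l x))

    a₂[σl+l]≈0 : (σ l + l) * a₂ ≈ 0#
    a₂[σl+l]≈0 = begin
      (σ l + l) * a₂       ≈⟨ solve 3 (λ m l a → (m :+ l) :* a := a :* m :+ a :* l) refl (σ l) l a₂ ⟩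
      a₂ * σ l + a₂ * l    ≈⟨ +-congʳ (*-congʳ (InFq⇒fixed a₂∈F)) ⟨
      σ a₂ * σ l + a₂ * l  ≈⟨ +-congʳ (A.σ-* a₂ l) ⟨
      σ (a₂ * l) + a₂ * l  ≈⟨ +-cong (A.σ-cong a₁≈a₂l) a₁≈a₂l ⟨
      σ a₁ + a₁            ≈⟨ +-congʳ (InFq⇒fixed a₁∈F) ⟩
      a₁ + a₁              ≈⟨ x+x≈0 a₁ ⟩
      0#                   ∎

    a₂≈0 : a₂ ≈ 0#
    a₂≈0 = xy≈0⇒y≈0 (λ σl+l≈0 → l∉F (+≈0⇒≈ σl+l≈0)) a₂[σl+l]≈0

  module _ (E : Embeddings.Embedding K 2≈0 8 𝔽₂₅₆) {r} (W : 𝔽₂₅₆-Frobenius.Witness r) where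
    open Embeddings.Embedding E
    open RawFrobenius 𝔽₂₅₆
    private
      module R = RawSemiring 𝔽₂₅₆
      module W = 𝔽₂₅₆-Frobenius.Witness W

      unit : ∀ p p⁻¹ → p R.* p⁻¹ ≡ R.1# → ¬ (⟦ p ⟧ ≈ 0#)
      unit p p⁻¹ pp⁻¹≡1 p≈0 = 1≉0 (begin
        1#                 ≈⟨ ⟦⟧-1 ⟨
        ⟦ R.1# ⟧           ≡⟨ ≡.cong ⟦_⟧ pp⁻¹≡1 ⟨
        ⟦ p R.* p⁻¹ ⟧      ≈⟨ ⟦⟧-* p p⁻¹ ⟩
        ⟦ p ⟧ * ⟦ p⁻¹ ⟧    ≈⟨ *-congʳ p≈0 ⟩
        0# * ⟦ p⁻¹ ⟧       ≈⟨ zeroˡ _ ⟩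
        0#                 ∎)

    witness⇒not-scattered : ∀ i → h ≡ r ℕ.+ i ℕ.* 8 → ¬ Scattered U
    witness⇒not-scattered i h≡ = not-scattered {⟦ W.l ⟧} {⟦ W.x ⟧} {⟦ W.y ⟧}
      (λ σl≈l → unit _ W.a⁻¹ W.a-unit (trans (⟦⟧-+ _ _) (trans (+-congʳ (sym (s W.l))) (≈⇒+≈0 σl≈l))))
      (unit W.x W.x⁻¹ W.x-unit)
      λ { zero                   → refl
        ; (suc zero)             → refl
        ; (suc (suc zero))       → begin
            ⟦ W.l ⟧ * (σ ⟦ W.x ⟧ + σ (σ ⟦ W.y ⟧))         ≈⟨ *-congˡ (form₁ W.x W.y) ⟩
            ⟦ W.l ⟧ * ⟦ F W.x R.+ F (F W.y) ⟧             ≈⟨ ⟦⟧-* _ _ ⟨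
            ⟦ W.l R.* (F W.x R.+ F (F W.y)) ⟧             ≡⟨ ≡.cong ⟦_⟧ W.eq₁ ⟩
            ⟦ F (W.l R.* W.x) R.+ F (F (W.l R.* W.y)) ⟧   ≈⟨ form₁ _ _ ⟨
            σ ⟦ W.l R.* W.x ⟧ + σ (σ ⟦ W.l R.* W.y ⟧)     ≈⟨ scaled (suc (suc zero)) ⟩
            σ (⟦ W.l ⟧ * ⟦ W.x ⟧) + σ (σ (⟦ W.l ⟧ * ⟦ W.y ⟧)) ∎
        ; (suc (suc (suc zero))) → begin
            ⟦ W.l ⟧ * (σ (σ ⟦ W.x ⟧) + σ ⟦ W.y ⟧ + σ (σ ⟦ W.y ⟧))  ≈⟨ *-congˡ (form₂ W.x W.y) ⟩
            ⟦ W.l ⟧ * ⟦ F (F W.x) R.+ F W.y R.+ F (F W.y) ⟧        ≈⟨ ⟦⟧-* _ _ ⟨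
            ⟦ W.l R.* (F (F W.x) R.+ F W.y R.+ F (F W.y)) ⟧        ≡⟨ ≡.cong ⟦_⟧ W.eq₂ ⟩
            ⟦ F (F (W.l R.* W.x)) R.+ F (W.l R.* W.y) R.+ F (F (W.l R.* W.y)) ⟧  ≈⟨ form₂ _ _ ⟨
            σ (σ ⟦ W.l R.* W.x ⟧) + σ ⟦ W.l R.* W.y ⟧ + σ (σ ⟦ W.l R.* W.y ⟧)    ≈⟨ scaled (suc (suc (suc zero))) ⟩
            σ (σ (⟦ W.l ⟧ * ⟦ W.x ⟧)) + σ (⟦ W.l ⟧ * ⟦ W.y ⟧) + σ (σ (⟦ W.l ⟧ * ⟦ W.y ⟧)) ∎ }
      where
      F : R.Carrier → R.Carrier
      F = frobᴿ r

      s : ∀ p → σ ⟦ p ⟧ ≈ ⟦ F p ⟧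
      s = σ-⟦⟧ r i h≡

      s² : ∀ p → σ (σ ⟦ p ⟧) ≈ ⟦ F (F p) ⟧
      s² p = trans (A.σ-cong (s p)) (s (F p))

      form₁ : ∀ p p′ → σ ⟦ p ⟧ + σ (σ ⟦ p′ ⟧) ≈ ⟦ F p R.+ F (F p′) ⟧
      form₁ p p′ = trans (+-cong (s p) (s² p′)) (sym (⟦⟧-+ _ _))

      form₂ : ∀ p p′ → σ (σ ⟦ p ⟧) + σ ⟦ p′ ⟧ + σ (σ ⟦ p′ ⟧) ≈ ⟦ F (F p) R.+ F p′ R.+ F (F p′) ⟧
      form₂ p p′ = trans (+-cong (trans (+-cong (s² p) (s p′)) (sym (⟦⟧-+ _ _))) (s² p′)) (sym (⟦⟧-+ _ _))

      scaled : ∀ i → vecσ ⟦ W.l R.* W.x ⟧ ⟦ W.l R.* W.y ⟧ i ≈ vecσ (⟦ W.l ⟧ * ⟦ W.x ⟧) (⟦ W.l ⟧ * ⟦ W.y ⟧) i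
      scaled = vecσ-cong (⟦⟧-* W.l W.x) (⟦⟧-* W.l W.y)

theorem4p1 : ∀ {c ℓ : Level} (h : ℕ) → h ≥ 1 →
    (K : Field c ℓ) → HasOrder K ((2 ^ h) ^ 4) →
    (Over.Subfield.MaximumScattered K (2 ^ h) (Thm.U K (2 ^ h)) 8 → h % 4 ≢ 2)
    × (h % 4 ≢ 2 → Over.Subfield.MaximumScattered K (2 ^ h) (Thm.U K (2 ^ h)) 8)
theorem4p1 h@(suc h′) _ K order = (λ (_ , scat) h%4≡2 → not-scattered-U h%4≡2 scat) ,
                                  (λ h%4≢2 → U-dimension-8 , scattered h%4≢2)
  where
  open Field K using (Carrier; _≈_; 1#; 0#; _+_)

  -- As h is a successor, so is the exponent h * 4, the form in which the root count for the trace
  -- takes it.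
  order′ : HasOrder K (2 ^ suc (3 ℕ.+ h′ ℕ.* 4))
  order′ = ≡.subst (HasOrder K) (ℕ.^-*-assoc 2 h 4) order

  2≈0 : 1# + 1# ≈ 0#
  2≈0 = FiniteField.char2 K order′ (h ℕ.* 4) ≡.refl

  open Char2 K 2≈0
  open Order {3 ℕ.+ h′ ℕ.* 4} order′

  frob-4h : ∀ x → frob (4 ℕ.* h) x ≈ x
  frob-4h x = ≡.subst (λ n → frob n x ≈ x) (ℕ.*-comm h 4) (frob-order x)

  θ : Carrier
  θ = proj₁ Tr≈1

  Tr-θ : Tr (4 ℕ.* h) θ ≈ 1#
  Tr-θ = ≡.subst (λ n → Tr n θ ≈ 1#) (ℕ.*-comm h 4) (proj₂ Tr≈1)

  open Frobenius4 K 2≈0 (FiniteField._≟_ K order) h frob-4h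
  open Basis θ Tr-θ

  not-scattered-U : h % 4 ≡ 2 → ¬ Over.Subfield.Scattered K (2 ^ h) (Thm.U K (2 ^ h))
  not-scattered-U h%4≡2 = case-mod-8 (2mod4⇒2or6mod8 h h%4≡2)
    where
    E : Embeddings.Embedding K 2≈0 8 𝔽₂₅₆
    E = Embeddings.embed-𝔽₂₅₆ K 2≈0 {j = 1 ℕ.+ (h ℕ./ 4) ℕ.* 2} (frob-4h θ) Tr-θ (2mod4⇒8∣4h h h%4≡2)

    h≡ : ∀ {r} → h % 8 ≡ r → h ≡ r ℕ.+ (h ℕ./ 8) ℕ.* 8
    h≡ h%8≡r = ≡.trans (ℕ.m≡m%n+[m/n]*n h 8) (≡.cong (ℕ._+ (h ℕ./ 8) ℕ.* 8) h%8≡r)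

    case-mod-8 : h % 8 ≡ 2 ⊎ h % 8 ≡ 6 → ¬ Over.Subfield.Scattered K (2 ^ h) (Thm.U K (2 ^ h))
    case-mod-8 (inj₁ h%8≡2) = witness⇒not-scattered E 𝔽₂₅₆-Frobenius.witness₂ (h ℕ./ 8) (h≡ h%8≡2)
    case-mod-8 (inj₂ h%8≡6) = witness⇒not-scattered E 𝔽₂₅₆-Frobenius.witness₆ (h ℕ./ 8) (h≡ h%8≡6)
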